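{- Let $D\ge 1$ and $N>2D$ be integers, let $q$ be a prime power, let $\Gamma=J_q(N,D)$ with adjacency matrix $A$, and let $x$ be a vertex of $\Gamma$. For every subspace $\alpha\subseteq x$, with $i=\dim\alpha$, $$A\alpha^{\mathcal{N}}=[D-i]\bigl(q[N-D]-[D-i]\bigr)\alpha^{\mathcal{N}}+q^{2D-2i-1}[N-2D+i+1]\sum_{\substack{\beta\subseteq x,\\ \beta\text{ covers }\alpha}}\beta^{\mathcal{N}}+q^{D-i}\sum_{\substack{\beta\subseteq x,\\ \alpha\text{ covers }\alpha\cap\beta,\\ \beta\text{ covers }\alpha\cap\beta}}\beta^{\mathcal{N}}+[D-i+1]\sum_{\alpha\text{ covers }\beta}\beta^{\mathcal{N}}.$$
   Context: Let $\mathbb{F}_q$ be a finite field with $q$ elements and $\mathcal{V}$ an $N$-dimensional vector space over $\mathbb{F}_q$. The Grassmann graph $\Gamma=J_q(N,D)$ has vertex set $X$ consisting of the $D$-dimensional subspaces of $\mathcal{V}$; $y,z\in X$ are adjacent iff $\dim(y\cap z)=D-1$. $[\ell]=\frac{q^\ell-1}{q-1}$ for integers $\ell$. For subspaces $u,v$ of $\mathcal{V}$, $v$ covers $u$ means $u\subseteq v$ and $\dim v=\dim u+1$. Let $V=\mathbb{C}^X$ (column vectors), and for $y\in X$ let $\widehat y\in V$ have $1$ in coordinate $y$ and $0$ elsewhere. For a subspace $\alpha\subseteq x$, $\alpha^{\mathcal{N}}=\sum_{y\in X,\ y\cap x=\alpha}\widehat y$. All sums in the claim run over subspaces $\beta$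 with the indicated properties. -}

module Defs where

open import Level using (_⊔_) renaming (suc to ℓ-suc)
open import Algebra.Bundles using (CommutativeRing; Semiring)
open import Algebra.Apartness.Bundles using (HeytingField; HeytingCommutativeRing)
open import Algebra.Module.Bundles using (Module)
import Algebra.Definitions.RawSemiring as RawSemiringDefinitions
import Algebra.Properties.CommutativeMonoid.Sum as CommutativeMonoidSum
import Algebra.Properties.Group as GroupProperties
open import Data.Bool.Base using (if_then_else_)
import Data.Bool.Properties as Bool
open import Data.Fin.Base using (Fin; zero; suc; toℕ; fromℕ<; combine; finToFun; funToFin)
import Data.Fin.Properties as Fin
open import Data.Fin.Subset as Subset using (Subset; inside; outside)
import Data.Fin.Subset.Properties as Subset
open import Data.Integer.Base using (ℤ; +_; -[1+_])
open import Data.List.Base using (List; []; _∷_; _++_; map; mapMaybe; filter; foldr)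
import Data.Maybe.Base as Maybe
open import Data.Nat.Base as ℕ using (ℕ; NonZero; _∸_; s≤s; z≤n)
import Data.Nat.Properties as ℕ
open import Data.Nat.Primality using (Prime)
open import Data.Product.Base using (∃; ∃₂; _×_; _,_; proj₁; proj₂)
open import Data.Unit.Base using (⊤; tt)
open import Data.Vec.Base using ([]; _∷_)
import Data.Vec.Properties as Vec
open import Data.Vec.Functional using (Vector)
open import Data.Vec.Functional.Relation.Binary.Equality.Setoid using (≋-setoid)
open import Function.Base using (_∘_)
open import Function.Bundles using (Inverse)
open import Function.Construct.Composition using (inverse)
open import Relation.Binary.Bundles using (Setoid)
import Relation.Binary.Definitions as B
open import Relation.Binary.PropositionalEquality as ≡ using (_≡_)
open import Relation.Nullary.Decidable
  using (Dec; yes; no; does; map′; _×-dec_; _→-dec_; dec⇒maybe)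
open import Relation.Nullary.Negation using (contradiction)
open import Relation.Unary using (Pred; Decidable)

PrimePower : ℕ → Set
PrimePower q = ∃₂ λ p k → Prime p × q ≡ p ℕ.^ ℕ.suc k

HasSize : ∀ {a ℓ} → Setoid a ℓ → ℕ → Set (a ⊔ ℓ)
HasSize S n = Inverse S (≡.setoid (Fin n))

module Finite {a ℓ} {S : Setoid a ℓ} {n : ℕ} (size : HasSize S n) where
  open Setoid S
  open Inverse size

  to-injective : ∀ {x y} → to x ≡ to y → x ≈ y
  to-injective eq = trans (sym (inverseʳ ≡.refl)) (inverseʳ eq)

  from-injective : ∀ {i j} → from i ≈ from j → i ≡ j
  from-injective eq = ≡.trans (≡.sym (inverseˡ refl)) (inverseˡ eq)

  infix 4 _≈?_
  _≈?_ : B.Decidable _≈_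
  x ≈? y = map′ to-injective to-cong (to x Fin.≟ to y)

  module _ {p} {P : Pred Carrier p} (resp : P B.Respects _≈_) (P? : Decidable P) where

    ∀? : Dec (∀ x → P x)
    ∀? = map′ (λ f x → resp (inverseʳ ≡.refl) (f (to x))) (λ f i → f (from i))
              (Fin.all? (P? ∘ from))

    ∃? : Dec (∃ P)
    ∃? = map′ (λ (i , p) → from i , p)
              (λ (x , p) → to x , resp (sym (inverseʳ ≡.refl)) p)
              (Fin.any? (P? ∘ from))

families-size : ∀ {a ℓ} {S : Setoid a ℓ} {n} → HasSize S n →
                ∀ k → HasSize (≋-setoid S k) (n ℕ.^ k)
families-size {S = S} size k = record
  { to        = λ f → funToFin (to ∘ f)
  ; from      = λ i → from ∘ finToFun i
  ; to-cong   = λ f≋g → funToFin-cong (to-cong ∘ f≋g)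
  ; from-cong = λ { ≡.refl _ → refl }
  ; inverse   =
      (λ {i} f≋ → ≡.trans (funToFin-cong (inverseˡ ∘ f≋)) (Fin.funToFin-finToFin {k} i))
    , (λ { {f} ≡.refl j → inverseʳ (Fin.finToFun-funToFin (to ∘ f) j) })
  }
  where
  open Setoid S
  open Inverse size
  funToFin-cong : ∀ {k m} {f g : Fin k → Fin m} → (∀ j → f j ≡ g j) → funToFin f ≡ funToFin g
  funToFin-cong {ℕ.zero}  _  = ≡.refl
  funToFin-cong {ℕ.suc _} eq = ≡.cong₂ combine (eq zero) (funToFin-cong (eq ∘ suc))

fieldRing : ∀ {c ℓ₁ ℓ₂} → HeytingField c ℓ₁ ℓ₂ → CommutativeRing c ℓ₁
fieldRing F = HeytingCommutativeRing.commutativeRing (HeytingField.heytingCommutativeRing F)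

module FieldProperties {c ℓ₁ ℓ₂} (F : HeytingField c ℓ₁ ℓ₂) where
  open CommutativeRing (fieldRing F)
  open HeytingField F using (_#_; #⇒invertible; invertible⇒#)

  x-0≈x : ∀ x → x - 0# ≈ x
  x-0≈x x = trans (+-congˡ (GroupProperties.ε⁻¹≈ε +-group)) (+-identityʳ x)

  1#0 : 1# # 0#
  1#0 = invertible⇒# (1# , trans (*-identityˡ _) (x-0≈x 1#) , trans (*-identityʳ _) (x-0≈x 1#))

  -- The inverse of x - y.
  recip : ∀ {x y} → x # y → Carrier
  recip x#y = proj₁ (#⇒invertible x#y)

record FiniteField (q : ℕ) c ℓ₁ ℓ₂ : Set (ℓ-suc (c ⊔ ℓ₁ ⊔ ℓ₂)) where
  field
    heytingField : HeytingField c ℓ₁ ℓ₂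
    size         : HasSize (CommutativeRing.setoid (fieldRing heytingField)) q

  1<q : 1 ℕ.< q
  1<q = bound q size
    where
    open HeytingField heytingField using (0#; 1#; #-irrefl)
    bound : ∀ n → HasSize (CommutativeRing.setoid (fieldRing heytingField)) n → 1 ℕ.< n
    bound 0 s with () ← Inverse.to s 0#
    bound 1 s = contradiction (FieldProperties.1#0 heytingField)
                              (#-irrefl (Finite.to-injective s (Fin1-prop _ _)))
      where
      Fin1-prop : (i j : Fin 1) → i ≡ j
      Fin1-prop zero zero = ≡.refl
    bound (ℕ.suc (ℕ.suc _)) _ = s≤s (s≤s z≤n)

-- The scalars of the standard module V. Agda's standard library has no complex numbers; any field
-- of characteristic zero is allowed in their place. A Heyting field carries an apartness relation
-- _#_ (the constructive form of ≠) and inverts every x - y with x # y.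
record CharZeroField c ℓ₁ ℓ₂ : Set (ℓ-suc (c ⊔ ℓ₁ ⊔ ℓ₂)) where
  field
    heytingField : HeytingField c ℓ₁ ℓ₂
  open CommutativeRing (fieldRing heytingField) public
  open HeytingField heytingField using (_#_; #⇒invertible; invertible⇒#) public
  open RawSemiringDefinitions (Semiring.rawSemiring semiring) using (_^_) renaming (_×_ to _×ⁿ_) public
  open FieldProperties heytingField public
  field
    characteristicZero : ∀ n → .{{NonZero n}} → (n ×ⁿ 1#) # 0#

module QNumbers {c ℓ₁ ℓ₂} (K : CharZeroField c ℓ₁ ℓ₂) {q : ℕ} (1<q : 1 ℕ.< q) where
  open CharZeroField K

  qᴷ : Carrier
  qᴷ = q ×ⁿ 1#

  qᴷ#0 : qᴷ # 0#
  qᴷ#0 = characteristicZero q {{ℕ.>-nonZero (ℕ.<-trans (s≤s z≤n) 1<q)}}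

  qᴷ#1 : qᴷ # 1#
  qᴷ#1 = go 1<q
    where
    go : ∀ {n} → 1 ℕ.< n → (n ×ⁿ 1#) # 1#
    go {ℕ.suc (ℕ.suc m)} (s≤s (s≤s _)) with #⇒invertible (characteristicZero (ℕ.suc m))
    ... | r , rl , rr = invertible⇒# (r , trans (*-congˡ eq) rl , trans (*-congʳ eq) rr)
      where
      y : Carrier
      y = ℕ.suc m ×ⁿ 1#
      eq : (1# + y) - 1# ≈ y - 0#
      eq = trans (+-congʳ (+-comm 1# y)) (trans (+-assoc y 1# (- 1#))
             (trans (+-congˡ (-‿inverseʳ 1#)) (trans (+-identityʳ y) (sym (x-0≈x y)))))

  infix 10 q^_
  q^_ : ℤ → Carrier
  q^ (+ n)     = qᴷ ^ n
  q^ -[1+ n ] = recip qᴷ#0 ^ ℕ.suc n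

  [_] : ℤ → Carrier
  [ ℓ ] = (q^ ℓ - 1#) * recip qᴷ#1

module Bases {a ℓ₁ ℓ₂} (F : HeytingField a ℓ₁ ℓ₂) {m ℓm} (M : Module (fieldRing F) m ℓm) where
  open CommutativeRing (fieldRing F)
  open Module M
  open CommutativeMonoidSum +ᴹ-commutativeMonoid using (sum; sum-cong-≋; ∑-distrib-+)

  combination : ∀ {d} → Vector Carrier d → Vector Carrierᴹ d → Carrierᴹ
  combination c b = sum (λ j → c j *ₗ b j)

  -- b is a basis of the subspace consisting of the vectors satisfying P.
  record IsBasis {p} (P : Pred Carrierᴹ p) {d} (b : Vector Carrierᴹ d)
      : Set (a ⊔ ℓ₁ ⊔ m ⊔ ℓm ⊔ p) where
    field
      member      : ∀ j → P (b j)
      independent : ∀ c → combination c b ≈ᴹ 0ᴹ → ∀ j → c j ≈ 0#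
      spanning    : ∀ v → P v → ∃ λ c → v ≈ᴹ combination c b

  combination-cong : ∀ {d} {c c′ : Vector Carrier d} {b b′ : Vector Carrierᴹ d} →
    (∀ j → c j ≈ c′ j) → (∀ j → b j ≈ᴹ b′ j) → combination c b ≈ᴹ combination c′ b′
  combination-cong c≈ b≈ = sum-cong-≋ (λ j → *ₗ-cong (c≈ j) (b≈ j))

  combination-+ : ∀ {d} (c c′ : Vector Carrier d) (b : Vector Carrierᴹ d) →
    combination (λ j → c j + c′ j) b ≈ᴹ combination c b +ᴹ combination c′ b
  combination-+ c c′ b = ≈ᴹ-trans (sum-cong-≋ (λ j → *ₗ-distribʳ (b j) (c j) (c′ j)))
                                  (∑-distrib-+ (λ j → c j *ₗ b j) (λ j → c′ j *ₗ b j))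

  module _ {p} {P : Pred Carrierᴹ p} {d} {b : Vector Carrierᴹ d} (isBasis : IsBasis P b) where
    open IsBasis isBasis

    combination-injective : ∀ c c′ → combination c b ≈ᴹ combination c′ b → ∀ j → c j ≈ c′ j
    combination-injective c c′ eq j =
      GroupProperties.x∙y⁻¹≈ε⇒x≈y +-group (c j) (c′ j) (independent diff diff≈0 j)
      where
      diff : Vector Carrier d
      diff i = c i - c′ i
      diff+c′≈c : ∀ i → diff i + c′ i ≈ c i
      diff+c′≈c i = trans (+-assoc (c i) (- c′ i) (c′ i))
                          (trans (+-congˡ (-‿inverseˡ (c′ i))) (+-identityʳ (c i)))
      diff≈0 : combination diff b ≈ᴹ 0ᴹ
      diff≈0 = GroupProperties.identityˡ-unique +ᴹ-group _ (combination c′ b)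
        (≈ᴹ-trans (≈ᴹ-sym (combination-+ diff c′ b))
          (≈ᴹ-trans (combination-cong diff+c′≈c (λ _ → ≈ᴹ-refl)) eq))

  IsBasis-resp : ∀ {p} {P : Pred Carrierᴹ p} → P B.Respects _≈ᴹ_ →
    ∀ {d} {b b′ : Vector Carrierᴹ d} → (∀ j → b j ≈ᴹ b′ j) → IsBasis P b → IsBasis P b′
  IsBasis-resp resp b≈ isBasis = record
    { member      = λ j → resp (b≈ j) (member j)
    ; independent = λ c eq → independent c (≈ᴹ-trans (combination-cong (λ _ → refl) b≈) eq)
    ; spanning    = λ v v∈P → let c , eq = spanning v v∈P in
                      c , ≈ᴹ-trans eq (combination-cong (λ _ → refl) b≈)
    }
    where open IsBasis isBasis

record VectorSpace {q a ℓ₁ ℓ₂} (F : FiniteField q a ℓ₁ ℓ₂) (N : ℕ) m ℓm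
    : Set (a ⊔ ℓ₁ ⊔ ℓ-suc (m ⊔ ℓm)) where
  private
    module F = FiniteField F
  field
    module′ : Module (fieldRing F.heytingField) m ℓm
  open Module module′ public
  open Bases F.heytingField module′ public
  field
    basis   : Vector Carrierᴹ N
    isBasis : IsBasis (λ _ → ⊤) basis

  coordinates : Inverse ≈ᴹ-setoid (≋-setoid (CommutativeRing.setoid (fieldRing F.heytingField)) N)
  coordinates = record
    { to        = coord
    ; from      = λ c → combination c basis
    ; to-cong   = λ {v} {w} v≈w → combination-injective isBasis (coord v) (coord w)
                    (≈ᴹ-trans (≈ᴹ-sym (coord-eq v)) (≈ᴹ-trans v≈w (coord-eq w)))
    ; from-cong = λ c≋ → combination-cong c≋ (λ _ → ≈ᴹ-refl)
    ; inverse   = (λ {c} {v} v≈ → combination-injective isBasis (coord v) c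
                                    (≈ᴹ-trans (≈ᴹ-sym (coord-eq v)) v≈))
                , (λ {v} c≋ → ≈ᴹ-trans (combination-cong c≋ (λ _ → ≈ᴹ-refl)) (≈ᴹ-sym (coord-eq v)))
    }
    where
    coord : Carrierᴹ → Vector (HeytingField.Carrier F.heytingField) N
    coord v = proj₁ (IsBasis.spanning isBasis v tt)
    coord-eq : ∀ v → v ≈ᴹ combination (coord v) basis
    coord-eq v = proj₂ (IsBasis.spanning isBasis v tt)

  size : HasSize ≈ᴹ-setoid (q ℕ.^ N)
  size = inverse coordinates (families-size F.size N)

allSubsets : ∀ n → List (Subset n)
allSubsets ℕ.zero    = [] ∷ []
allSubsets (ℕ.suc n) = map (outside ∷_) (allSubsets n) ++ map (inside ∷_) (allSubsets n)

collect : ∀ {a b p} {A : Set a} {B : Set b} {P : Pred A p} →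
          Decidable P → ((x : A) → .(P x) → B) → List A → List B
collect P? f = mapMaybe (λ x → Maybe.map (λ p → f x p) (dec⇒maybe (P? x)))

module Subspaces {q a ℓ₁ ℓ₂} (F : FiniteField q a ℓ₁ ℓ₂) {N m ℓm} (𝒱 : VectorSpace F N m ℓm) where
  private
    module F = FiniteField F
  open CommutativeRing (fieldRing F.heytingField) using (Carrier; setoid; _≈_; 0#)
  open VectorSpace 𝒱

  -- A set of vectors is a Subset of the finite index set Fin (q ^ N) of 𝒱, so that equality of
  -- sets of vectors is propositional equality.
  VectorSet : Set
  VectorSet = Subset (q ℕ.^ N)

  infix 4 _∈ᵥ_ _∈ᵥ?_
  _∈ᵥ_ : Carrierᴹ → VectorSet → Set
  v ∈ᵥ U = Inverse.to size v Subset.∈ U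

  _∈ᵥ?_ : ∀ v U → Dec (v ∈ᵥ U)
  v ∈ᵥ? U = Inverse.to size v Subset.∈? U

  ∈ᵥ-resp : ∀ {U} → (_∈ᵥ U) B.Respects _≈ᴹ_
  ∈ᵥ-resp {U} v≈w = ≡.subst (Subset._∈ U) (Inverse.to-cong size v≈w)

  record IsSubspace (U : VectorSet) : Set (a ⊔ m) where
    field
      0-closed : 0ᴹ ∈ᵥ U
      +-closed : ∀ v → v ∈ᵥ U → ∀ w → w ∈ᵥ U → (v +ᴹ w) ∈ᵥ U
      *-closed : ∀ (c : Carrier) v → v ∈ᵥ U → (c *ₗ v) ∈ᵥ U

  private
    module 𝔽 = Finite F.size
    module 𝕍 = Finite size

  isSubspace? : Decidable IsSubspace
  isSubspace? U = map′
    (λ (z , p , s) → record { 0-closed = z ; +-closed = p ; *-closed = s })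
    (λ s → let open IsSubspace s in 0-closed , +-closed , *-closed)
    (0ᴹ ∈ᵥ? U
      ×-dec 𝕍.∀? (λ v≈ h v∈ w w∈ → ∈ᵥ-resp (+ᴹ-congʳ v≈) (h (∈ᵥ-resp (≈ᴹ-sym v≈) v∈) w w∈))
              (λ v → (v ∈ᵥ? U) →-dec
                𝕍.∀? (λ w≈ h w∈ → ∈ᵥ-resp (+ᴹ-congˡ w≈) (h (∈ᵥ-resp (≈ᴹ-sym w≈) w∈)))
                     (λ w → (w ∈ᵥ? U) →-dec ((v +ᴹ w) ∈ᵥ? U)))
      ×-dec 𝔽.∀? (λ c≈ h v v∈ → ∈ᵥ-resp (*ₗ-congʳ c≈) (h v v∈))
              (λ c → 𝕍.∀? (λ v≈ h v∈ → ∈ᵥ-resp (*ₗ-congˡ v≈) (h (∈ᵥ-resp (≈ᴹ-sym v≈) v∈)))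
                          (λ v → (v ∈ᵥ? U) →-dec ((c *ₗ v) ∈ᵥ? U))))

  -- The proof is irrelevant, so that subspaces with the same vectors are equal.
  record Subspace : Set (a ⊔ m) where
    constructor subspace
    field
      vectors     : VectorSet
      .isSubspace : IsSubspace vectors
  open Subspace public

  subspaces : List Subspace
  subspaces = collect isSubspace? subspace (allSubsets (q ℕ.^ N))

  infix 4 _≟_
  _≟_ : B.DecidableEquality Subspace
  U ≟ W = map′ (λ { ≡.refl → ≡.refl }) (≡.cong vectors)
               (Vec.≡-dec Bool._≟_ (vectors U) (vectors W))

  infix 4 _⊆_ _⊆?_
  _⊆_ : Subspace → Subspace → Set
  U ⊆ W = vectors U Subset.⊆ vectors W

  _⊆?_ : B.Decidable _⊆_
  U ⊆? W = vectors U Subset.⊆? vectors W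

  infixr 7 _∩_
  _∩_ : Subspace → Subspace → Subspace
  subspace U sU ∩ subspace W sW = subspace (U Subset.∩ W) (closed sU sW)
    where
    closed : IsSubspace U → IsSubspace W → IsSubspace (U Subset.∩ W)
    closed sU sW = record
      { 0-closed = both (IsSubspace.0-closed sU , IsSubspace.0-closed sW)
      ; +-closed = λ v v∈ w w∈ → both ( IsSubspace.+-closed sU v (left v∈) w (left w∈)
                                      , IsSubspace.+-closed sW v (right v∈) w (right w∈))
      ; *-closed = λ c v v∈ → both ( IsSubspace.*-closed sU c v (left v∈)
                                   , IsSubspace.*-closed sW c v (right v∈))
      }
      where
      both : ∀ {i} → i Subset.∈ U × i Subset.∈ W → i Subset.∈ U Subset.∩ W
      both = Subset.x∈p∩q⁺
      left : ∀ {i} → i Subset.∈ U Subset.∩ W → i Subset.∈ U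
      left i∈ = proj₁ (Subset.x∈p∩q⁻ U W i∈)
      right : ∀ {i} → i Subset.∈ U Subset.∩ W → i Subset.∈ W
      right i∈ = proj₂ (Subset.x∈p∩q⁻ U W i∈)

  HasDim : Subspace → ℕ → Set (a ⊔ ℓ₁ ⊔ m ⊔ ℓm)
  HasDim U d = ∃ λ (b : Vector Carrierᴹ d) → IsBasis (_∈ᵥ vectors U) b

  hasDim? : B.Decidable HasDim
  hasDim? U d = Finite.∃? (families-size size d) (IsBasis-resp ∈ᵥ-resp) λ b → map′
    (λ (i , j , k) → record { member = i ; independent = j ; spanning = k })
    (λ s → let open IsBasis s in member , independent , spanning)
    (Fin.all? (λ j → b j ∈ᵥ? vectors U)
      ×-dec 𝔽ᵈ.∀? (λ c≈ h eq j → trans (sym (c≈ j))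
                     (h (≈ᴹ-trans (combination-cong c≈ (λ _ → ≈ᴹ-refl)) eq) j))
              (λ c → (combination c b 𝕍.≈? 0ᴹ) →-dec Fin.all? (λ j → c j 𝔽.≈? 0#))
      ×-dec 𝕍.∀? (λ v≈ h v∈ → let c , eq = h (∈ᵥ-resp (≈ᴹ-sym v≈) v∈) in
                                 c , ≈ᴹ-trans (≈ᴹ-sym v≈) eq)
              (λ v → (v ∈ᵥ? vectors U) →-dec
                𝔽ᵈ.∃? (λ c≈ eq → ≈ᴹ-trans eq (combination-cong c≈ (λ _ → ≈ᴹ-refl)))
                      (λ c → v 𝕍.≈? combination c b)))
    where
    module 𝔽ᵈ = Finite (families-size F.size d)
    open Setoid setoid using (sym; trans)

  hasDim⇒≤ : ∀ U {d} → HasDim U d → d ℕ.≤ N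
  hasDim⇒≤ U {d} (b , isBasisᵇ) = ℕ.≮⇒≥ λ N<d →
    ℕ.<⇒≱ (ℕ.^-monoʳ-< q F.1<q N<d) (Fin.injective⇒≤ {f = code} λ {i} {j} eq →
      𝔽ᵈ.from-injective (combination-injective isBasisᵇ _ _ (𝕍.to-injective eq)))
    where
    module 𝔽ᵈ = Finite (families-size F.size d)
    code : Fin (q ℕ.^ d) → Fin (q ℕ.^ N)
    code i = Inverse.to size (combination (Inverse.from (families-size F.size d) i) b)

  infix 4 _covers_ _covers?_
  _covers_ : Subspace → Subspace → Set (a ⊔ ℓ₁ ⊔ m ⊔ ℓm)
  W covers U = U ⊆ W × ∃ λ d → HasDim U d × HasDim W (ℕ.suc d)

  _covers?_ : B.Decidable _covers_
  W covers? U = U ⊆? W ×-dec map′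
    (λ (d , h) → toℕ d , h)
    (λ (d , hU , hW) → let d<1+N = s≤s (hasDim⇒≤ U hU) in
      fromℕ< d<1+N , ≡.subst (λ e → HasDim U e × HasDim W (ℕ.suc e))
                             (≡.sym (Fin.toℕ-fromℕ< d<1+N)) (hU , hW))
    (Fin.any? {n = ℕ.suc N} (λ d → hasDim? U (toℕ d) ×-dec hasDim? W (ℕ.suc (toℕ d))))

module Grassmann {q a ℓ₁ ℓ₂} (F : FiniteField q a ℓ₁ ℓ₂) {N m ℓm} (𝒱 : VectorSpace F N m ℓm)
    (D : ℕ) {k ℓ₃ ℓ₄} (K : CharZeroField k ℓ₃ ℓ₄) where
  open Subspaces F 𝒱 public
  open QNumbers K (FiniteField.1<q F) using (qᴷ; q^_; [_]) public
  open CharZeroField K using (0#; 1#)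
    renaming (Carrier to 𝕂; _≈_ to _≈ᴷ_; _+_ to _+ᴷ_; _-_ to _-ᴷ_; _*_ to _*ᴷ_) public

  record Vertex : Set (a ⊔ ℓ₁ ⊔ m ⊔ ℓm) where
    constructor vertex
    field
      space   : Subspace
      .hasDim : HasDim space D
  open Vertex public

  vertices : List Vertex
  vertices = collect (λ U → hasDim? U D) vertex subspaces

  -- For D = 0 the truncated D ∸ 1 is not D - 1; it is only used with D ≥ 1.
  Adjacent : Vertex → Vertex → Set (a ⊔ ℓ₁ ⊔ m ⊔ ℓm)
  Adjacent y z = HasDim (space y ∩ space z) (D ∸ 1)

  adjacent? : B.Decidable Adjacent
  adjacent? y z = hasDim? (space y ∩ space z) (D ∸ 1)

  V : Set (a ⊔ ℓ₁ ⊔ m ⊔ ℓm ⊔ k)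
  V = Vertex → 𝕂

  infix 4 _≈ⱽ_
  _≈ⱽ_ : V → V → Set (a ⊔ ℓ₁ ⊔ m ⊔ ℓm ⊔ ℓ₃)
  u ≈ⱽ v = ∀ y → u y ≈ᴷ v y

  infixl 6 _+ⱽ_
  _+ⱽ_ : V → V → V
  (u +ⱽ v) y = u y +ᴷ v y

  0ⱽ : V
  0ⱽ _ = 0#

  infixr 7 _·_
  _·_ : 𝕂 → V → V
  (c · v) y = c *ᴷ v y

  ∑ : ∀ {b p} {B : Set b} {P : Pred B p} → List B → Decidable P → (B → V) → V
  ∑ xs P? f = foldr _+ⱽ_ 0ⱽ (map f (filter P? xs))

  hat : Vertex → V
  hat y z = if does (space y ≟ space z) then 1# else 0#

  Matrix : Set (a ⊔ ℓ₁ ⊔ m ⊔ ℓm ⊔ k)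
  Matrix = Vertex → Vertex → 𝕂

  infixr 7 _*ⱽ_
  _*ⱽ_ : Matrix → V → V
  (B *ⱽ v) y = foldr _+ᴷ_ 0# (map (λ z → B y z *ᴷ v z) vertices)

  A : Matrix
  A y z = if does (adjacent? y z) then 1# else 0#

  infix 8 _^𝒩[_]
  _^𝒩[_] : Subspace → Vertex → V
  α ^𝒩[ x ] = ∑ vertices (λ y → (space y ∩ space x) ≟ α) hat

{-# OPTIONS --safe #-}

-- Evaluate both sides at a vertex z and put γ = z ∩ x. The right-hand side is the coefficient selected
-- by the position of γ relative to α; the left-hand side is the number of neighbours y of z with
-- y ∩ x = α. For such y the hyperplane h = y ∩ z of z satisfies h ∩ x = δ, where δ = α ∩ γ; since h is
-- also a hyperplane of y, δ has codimension at most one in α and in γ, which leaves four cases. If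
-- γ = δ, the h are the hyperplanes of z over γ, otherwise those over δ and not over γ. If α = δ, the y
-- through h are the h + ⟨ v ⟩ with v outside z and h + x, otherwise only h + α. All these numbers are
-- found by double counting with vectors, since a d-dimensional space has q ^ d of them.
module Submission where

open import Defs
open import Algebra.Apartness.Bundles using (HeytingField)
open import Algebra.Bundles using (CommutativeMonoid; CommutativeRing)
import Algebra.Properties.AbelianGroup as AbelianGroupProperties
import Algebra.Properties.CommutativeSemigroup as CommutativeSemigroupProperties
import Algebra.Properties.Semiring.Mult as SemiringMult
open import Data.Bool.Base using (if_then_else_)
import Data.Bool.Properties as Bool
open import Data.Fin.Base using (Fin; zero; suc)
open import Data.Fin.Subset as Subset using (Subset; inside; outside)
import Data.Fin.Subset.Properties as Subset
import Data.Integer.Base as ℤ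
import Data.Integer.Properties as ℤ
open import Data.List.Base using (List; []; _∷_; _++_; map; foldr; tabulate)
import Data.List.Properties as List
open import Data.Nat.Base as ℕ
  using (ℕ; zero; suc; pred; _+_; _*_; _∸_; _^_; _≤_; _<_; _≥_; _>_; s≤s; z≤n; NonZero)
open import Data.Nat.ListAction using (sum)
open import Data.Nat.ListAction.Properties using (sum-++)
import Data.Nat.Properties as ℕ
open import Data.Nat.Solver using (module +-*-Solver)
open import Data.Product.Base using (∃; _×_; _,_; proj₁; proj₂)
open import Data.Sum.Base using (_⊎_; inj₁; inj₂; [_,_]′)
open import Data.Unit.Base using (⊤; tt)
import Data.Vec.Base as Vec
open import Data.Vec.Functional using (Vector)
import Data.Vec.Properties as Vec
open import Function.Base using (_∘_; id)
open import Function.Bundles using (Inverse)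
open import Relation.Binary.Bundles using (Setoid)
import Relation.Binary.Definitions as B
open import Relation.Binary.PropositionalEquality as ≡ using (_≡_; _≢_; refl)
import Relation.Binary.Reasoning.Setoid as SetoidReasoning
open import Relation.Nullary.Decidable
  using (Dec; yes; no; does; map′; _×-dec_; ¬?; dec-true; decidable-stable; recompute)
open import Relation.Nullary.Negation using (¬_; contradiction)
open import Relation.Unary using (Pred; Decidable)
open +-*-Solver using (solve; _:=_; _:+_; _:*_; con)

-- Counting with lists

-- The `v` to be avoided fill `z` and `h + x`, and the intersection of these two decides the count.
-- If `γ = α`, then `(h + x) ∩ z = h`. If `γ` covers `α = δ`, then `γ` is not inside `h`, so
-- `h + γ = z` and `h + x` contains all of `z`. Dividing the number of remaining `v` by
-- `q ^ (D - 1) (q - 1)`, the number of vectors of `y` outside `h`, gives `q [N - D] - [D - i]` and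
-- `q ^ (D - i) [N - 2D + i + 1]`. Times the number of `h`, which is `[D - i]` and
-- `q ^ (D - i - 1)`, these are the first two coefficients; the other two are numbers of `h` alone.
-- Counting stays in the natural numbers: a double count gives an equation between multiples, from
-- which a nonzero factor is cancelled, and inclusion-exclusion is written with sums on both sides.
-- The scalars enter at the end, where one coefficient resists: for `i = D` the exponent
-- `2D - 2i - 1` is `-1`, so the second coefficient is not a count. But then no `β` inside `x`
-- covers `α`, so its value is only compared with a count when `i < D`.

total : ∀ {a} {A : Set a} → List A → (A → ℕ) → ℕ
total xs f = sum (map f xs)

module _ {a} {A : Set a} where

  total-cong : ∀ (xs : List A) {f g} → (∀ x → f x ≡ g x) → total xs f ≡ total xs g
  total-cong []       f≗g = refl
  total-cong (x ∷ xs) f≗g = ≡.cong₂ _+_ (f≗g x) (total-cong xs f≗g)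

  total-0 : ∀ (xs : List A) → total xs (λ _ → 0) ≡ 0
  total-0 []       = refl
  total-0 (x ∷ xs) = total-0 xs

  total-+ : ∀ (xs : List A) f g → total xs (λ x → f x + g x) ≡ total xs f + total xs g
  total-+ []       f g = refl
  total-+ (x ∷ xs) f g = ≡.trans (≡.cong (f x + g x +_) (total-+ xs f g))
    (CommutativeSemigroupProperties.interchange ℕ.+-commutativeSemigroup (f x) (g x) _ _)

  total-*ˡ : ∀ (xs : List A) k f → total xs (λ x → k * f x) ≡ k * total xs f
  total-*ˡ []       k f = ≡.sym (ℕ.*-zeroʳ k)
  total-*ˡ (x ∷ xs) k f = ≡.trans (≡.cong (k * f x +_) (total-*ˡ xs k f))
                                  (≡.sym (ℕ.*-distribˡ-+ k (f x) _))

  total-*ʳ : ∀ (xs : List A) k f → total xs (λ x → f x * k) ≡ total xs f * k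
  total-*ʳ xs k f = ≡.trans (total-cong xs (λ x → ℕ.*-comm (f x) k))
    (≡.trans (total-*ˡ xs k f) (ℕ.*-comm k _))

total-swap : ∀ {a b} {A : Set a} {B : Set b} (xs : List A) (ys : List B) (f : A → B → ℕ) →
  total xs (λ x → total ys (f x)) ≡ total ys (λ y → total xs (λ x → f x y))
total-swap []       ys f = ≡.sym (total-0 ys)
total-swap (x ∷ xs) ys f = ≡.trans (≡.cong (total ys (f x) +_) (total-swap xs ys f))
                                   (≡.sym (total-+ ys (f x) (λ y → total xs (λ x → f x y))))

module _ {p} {P : Set p} where

  abstract

    -- Opaque, so that the finite searches behind the decisions are never run; the lemmas on `𝟙` in
    -- the abstract blocks are the interface to its value.
    𝟙 : Dec P → ℕ
    𝟙 P? = if does P? then 1 else 0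

    𝟙-yes : (P? : Dec P) → P → 𝟙 P? ≡ 1
    𝟙-yes (yes _)  _ = refl
    𝟙-yes (no ¬p) p = contradiction p ¬p

    𝟙-no : (P? : Dec P) → ¬ P → 𝟙 P? ≡ 0
    𝟙-no (yes p) ¬p = contradiction p ¬p
    𝟙-no (no _)  _  = refl

    ≡*𝟙 : ∀ {n k} (P? : Dec P) → (P → n ≡ k) → (¬ P → n ≡ 0) → n ≡ k * 𝟙 P?
    ≡*𝟙 {k = k} (yes p) f g = ≡.trans (f p) (≡.sym (ℕ.*-identityʳ k))
    ≡*𝟙 {k = k} (no ¬p) f g = ≡.trans (g ¬p) (≡.sym (ℕ.*-zeroʳ k))

abstract

  𝟙-⇔ : ∀ {p r} {P : Set p} {Q : Set r} (P? : Dec P) (Q? : Dec Q) →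
         (P → Q) → (Q → P) → 𝟙 P? ≡ 𝟙 Q?
  𝟙-⇔ (yes p) Q? f g = ≡.sym (𝟙-yes Q? (f p))
  𝟙-⇔ (no ¬p) Q? f g = ≡.sym (𝟙-no Q? (¬p ∘ g))

  𝟙-× : ∀ {p r} {P : Set p} {Q : Set r} (P? : Dec P) (Q? : Dec Q) → 𝟙 (P? ×-dec Q?) ≡ 𝟙 P? * 𝟙 Q?
  𝟙-× (yes _) (yes _) = refl
  𝟙-× (yes _) (no _)  = refl
  𝟙-× (no _)  _       = refl

  𝟙-split : ∀ {p r} {P : Set p} {Q : Set r} (P? : Dec P) (Q? : Dec Q) →
            𝟙 P? ≡ 𝟙 (P? ×-dec Q?) + 𝟙 (P? ×-dec ¬? Q?)
  𝟙-split (yes _) (yes _) = refl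
  𝟙-split (yes _) (no _)  = refl
  𝟙-split (no _)  _       = refl

module _ {a} {A : Set a} where

  count : ∀ {p} {P : Pred A p} → List A → Decidable P → ℕ
  count xs P? = total xs (𝟙 ∘ P?)

  count-⇔ : ∀ {p r} {P : Pred A p} {Q : Pred A r} xs (P? : Decidable P) (Q? : Decidable Q) →
    (∀ x → P x → Q x) → (∀ x → Q x → P x) → count xs P? ≡ count xs Q?
  count-⇔ xs P? Q? f g = total-cong xs (λ x → 𝟙-⇔ (P? x) (Q? x) (f x) (g x))

  count-none : ∀ {p} {P : Pred A p} xs (P? : Decidable P) → (∀ x → ¬ P x) → count xs P? ≡ 0
  count-none xs P? none = ≡.trans (total-cong xs (λ x → 𝟙-no (P? x) (none x))) (total-0 xs)

  count-split : ∀ {p r} {P : Pred A p} {Q : Pred A r} xs (P? : Decidable P) (Q? : Decidable Q) →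
    count xs P? ≡ count xs (λ x → P? x ×-dec Q? x) + count xs (λ x → P? x ×-dec ¬? (Q? x))
  count-split xs P? Q? =
    ≡.trans (total-cong xs (λ x → 𝟙-split (P? x) (Q? x))) (total-+ xs _ _)

-- Both sides are the number of pairs in `R`, summed by rows and by columns; rows outside `P` and
-- columns outside `Q` are empty. No division occurs, and callers cancel `k` when it is nonzero.
double-count : ∀ {a b p r s} {A : Set a} {B : Set b} (xs : List A) (ys : List B)
  {R : A → B → Set r} {P : Pred A p} {Q : Pred B s}
  (R? : B.Decidable R) (P? : Decidable P) (Q? : Decidable Q) k l →
  (∀ x → P x → count ys (R? x) ≡ k) → (∀ x y → R x y → P x) →
  (∀ y → Q y → count xs (λ x → R? x y) ≡ l) → (∀ x y → R x y → Q y) →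
  k * count xs P? ≡ l * count ys Q?
double-count xs ys R? P? Q? k l rows R⇒P cols R⇒Q = begin
  k * count xs P?                            ≡⟨ total-*ˡ xs k _ ⟨
  total xs (λ x → k * 𝟙 (P? x))              ≡⟨ total-cong xs (λ x → ≡.sym (≡*𝟙 (P? x) (rows x)
                                                  (λ ¬Px → count-none ys (R? x) (λ y → ¬Px ∘ R⇒P x y)))) ⟩
  total xs (λ x → total ys (𝟙 ∘ R? x))       ≡⟨ total-swap xs ys _ ⟩
  total ys (λ y → count xs (λ x → R? x y))   ≡⟨ total-cong ys (λ y → ≡*𝟙 (Q? y) (cols y)
                                                  (λ ¬Qy → count-none xs (λ x → R? x y) (λ x → ¬Qy ∘ R⇒Q x y))) ⟩
  total ys (λ y → l * 𝟙 (Q? y))              ≡⟨ total-*ˡ ys l _ ⟩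
  l * count ys Q?                            ∎
  where open ≡.≡-Reasoning

Enumerates : ∀ {a ℓ} {A : Set a} {_≈_ : A → A → Set ℓ} → B.Decidable _≈_ → List A → Set a
Enumerates _≈?_ xs = ∀ w → count xs (_≈? w) ≡ 1

module Enumeration {a ℓ} {A : Set a} {_≈_ : A → A → Set ℓ} (_≈?_ : B.Decidable _≈_)
    (xs : List A) (once : Enumerates _≈?_ xs) where

  pick : ∀ w (f : A → ℕ) → (∀ x → x ≈ w → f x ≡ f w) → total xs (λ x → 𝟙 (x ≈? w) * f x) ≡ f w
  pick w f resp = begin
    total xs (λ x → 𝟙 (x ≈? w) * f x) ≡⟨ total-cong xs (λ x → pointwise x (x ≈? w)) ⟩
    total xs (λ x → 𝟙 (x ≈? w) * f w) ≡⟨ total-*ʳ xs (f w) _ ⟩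
    total xs (λ x → 𝟙 (x ≈? w)) * f w ≡⟨ ≡.cong (_* f w) (once w) ⟩
    1 * f w                           ≡⟨ ℕ.*-identityˡ (f w) ⟩
    f w                               ∎
    where
    open ≡.≡-Reasoning
    pointwise : ∀ x (d : Dec (x ≈ w)) → 𝟙 d * f x ≡ 𝟙 d * f w
    pointwise x d@(yes eq) = ≡.cong (𝟙 d *_) (resp x eq)
    pointwise x d@(no ¬eq) = ≡.trans (≡.cong (_* f x) (𝟙-no d ¬eq)) (≡.sym (≡.cong (_* f w) (𝟙-no d ¬eq)))

  count-unique : ∀ {p} {P : Pred A p} (P? : Decidable P) w →
    (∀ x → x ≈ w → P x) → (∀ x → P x → x ≈ w) → count xs P? ≡ 1
  count-unique P? w f g = ≡.trans (count-⇔ xs P? (_≈? w) g f) (once w)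

sum-tabulate-single : ∀ {n} (g : Fin n → ℕ) j → g j ≡ 1 → (∀ i → i ≢ j → g i ≡ 0) →
                      sum (tabulate g) ≡ 1
sum-tabulate-single g zero    gj g≢j = ≡.cong₂ _+_ gj (zeros (λ i → g (suc i)) (λ i → g≢j (suc i) (λ ())))
  where
  zeros : ∀ {n} (g : Fin n → ℕ) → (∀ i → g i ≡ 0) → sum (tabulate g) ≡ 0
  zeros {zero}  g g≡0 = refl
  zeros {suc n} g g≡0 = ≡.cong₂ _+_ (g≡0 zero) (zeros (g ∘ suc) (g≡0 ∘ suc))
sum-tabulate-single g (suc j) gj g≢j = ≡.cong₂ _+_ (g≢j zero (λ ()))
  (sum-tabulate-single (g ∘ suc) j gj (λ i i≢j → g≢j (suc i) (λ { refl → i≢j refl })))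

module _ {a ℓ} {S : Setoid a ℓ} {n} (size : HasSize S n) where
  open Setoid S using (Carrier)
  open Inverse size
  open Finite size using (_≈?_)

  elements : List Carrier
  elements = tabulate from

  elements-enumerates : Enumerates _≈?_ elements
  elements-enumerates w = ≡.trans (≡.cong sum (List.map-tabulate from (λ v → 𝟙 (v ≈? w))))
    (sum-tabulate-single _ (to w) (𝟙-yes (from (to w) ≈? w) (inverseʳ refl))
      (λ i i≢ → 𝟙-no (from i ≈? w) (λ eq → i≢ (≡.trans (≡.sym (inverseˡ (Setoid.refl S))) (to-cong eq)))))

  count-elements : count elements (λ _ → yes tt) ≡ n
  count-elements = ≡.trans (total-cong elements (λ _ → 𝟙-yes (yes tt) tt))
    (≡.trans (≡.cong sum (List.map-tabulate from (λ _ → 1))) (ones n))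
    where
    ones : ∀ m → sum (tabulate {n = m} (λ _ → 1)) ≡ m
    ones zero    = refl
    ones (suc m) = ≡.cong suc (ones m)

-- Subspaces of a finite vector space

^-reflects-≤ : ∀ {q} → 1 < q → ∀ {m n} → q ^ m ≤ q ^ n → m ≤ n
^-reflects-≤ {q} 1<q {m} {n} le = ℕ.≮⇒≥ (λ n<m → ℕ.<⇒≱ (ℕ.^-monoʳ-< q 1<q n<m) le)

^-injective : ∀ {q} → 1 < q → ∀ {m n} → q ^ m ≡ q ^ n → m ≡ n
^-injective 1<q eq = ℕ.≤-antisym (^-reflects-≤ 1<q (ℕ.≤-reflexive eq))
                                 (^-reflects-≤ 1<q (ℕ.≤-reflexive (≡.sym eq)))

total-++ : ∀ {a} {A : Set a} (xs ys : List A) f → total (xs ++ ys) f ≡ total xs f + total ys f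
total-++ xs ys f = ≡.trans (≡.cong sum (List.map-++ f xs ys)) (sum-++ (map f xs) (map f ys))

total-map : ∀ {a b} {A : Set a} {B : Set b} (g : A → B) xs f → total (map g xs) f ≡ total xs (f ∘ g)
total-map g xs f = ≡.cong sum (≡.sym (List.map-∘ xs))

total-mono-≤ : ∀ {a} {A : Set a} (xs : List A) {f g : A → ℕ} → (∀ x → f x ≤ g x) →
               total xs f ≤ total xs g
total-mono-≤ []       f≤g = z≤n
total-mono-≤ (x ∷ xs) f≤g = ℕ.+-mono-≤ (f≤g x) (total-mono-≤ xs f≤g)

count-mono : ∀ {a p r} {A : Set a} {P : Pred A p} {Q : Pred A r} xs (P? : Decidable P)
  (Q? : Decidable Q) → (∀ x → P x → Q x) → count xs P? ≤ count xs Q?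
count-mono xs P? Q? f = total-mono-≤ xs (λ x → pointwise (P? x) (Q? x) (f x))
  where
  pointwise : ∀ {p r} {P : Set p} {Q : Set r} (P? : Dec P) (Q? : Dec Q) → (P → Q) → 𝟙 P? ≤ 𝟙 Q?
  pointwise (yes p) Q? f = ℕ.≤-reflexive (≡.trans (𝟙-yes (yes p) p) (≡.sym (𝟙-yes Q? (f p))))
  pointwise (no ¬p) Q? f = ≡.subst (_≤ 𝟙 Q?) (≡.sym (𝟙-no (no ¬p) ¬p)) z≤n

-- The selection made by `collect` becomes an indicator factor. Since the proof passed to `f` is
-- irrelevant, the summand can be described by a function `h` of `x` alone.
total-collect : ∀ {a b p} {A : Set a} {B : Set b} {P : Pred A p} (P? : Decidable P)
  (f : (x : A) → .(P x) → B) (g : B → ℕ) (h : A → ℕ) → (∀ x (p : P x) → g (f x p) ≡ h x) →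
  ∀ xs → total (collect P? f xs) g ≡ total xs (λ x → 𝟙 (P? x) * h x)
total-collect P? f g h eq []       = refl
total-collect P? f g h eq (x ∷ xs) with P? x
... | yes p = ≡.cong₂ _+_
                (≡.trans (eq x p) (≡.sym (≡.trans (≡.cong (_* h x) (𝟙-yes (yes p) p)) (ℕ.*-identityˡ (h x)))))
                              (total-collect P? f g h eq xs)
... | no ¬p = ≡.trans (total-collect P? f g h eq xs)
                      (≡.cong (λ n → n * h x + total xs (λ x → 𝟙 (P? x) * h x)) (≡.sym (𝟙-no (no ¬p) ¬p)))

_≟ˢ_ : ∀ {n} → B.DecidableEquality (Subset n)
_≟ˢ_ = Vec.≡-dec Bool._≟_

allSubsets-enumerates : ∀ n → Enumerates (_≟ˢ_ {n}) (allSubsets n)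
allSubsets-enumerates zero    Vec.[] = ≡.cong (_+ 0) (𝟙-yes (_≟ˢ_ {zero} Vec.[] Vec.[]) refl)
allSubsets-enumerates (suc n) (b Vec.∷ s) = begin
  count (map (outside Vec.∷_) ss ++ map (inside Vec.∷_) ss) (_≟ˢ (b Vec.∷ s))
    ≡⟨ total-++ (map (outside Vec.∷_) ss) _ _ ⟩
  count (map (outside Vec.∷_) ss) (_≟ˢ (b Vec.∷ s)) + count (map (inside Vec.∷_) ss) (_≟ˢ (b Vec.∷ s))
    ≡⟨ ≡.cong₂ _+_ (total-map _ ss _) (total-map _ ss _) ⟩
  count ss (λ t → (outside Vec.∷ t) ≟ˢ (b Vec.∷ s)) + count ss (λ t → (inside Vec.∷ t) ≟ˢ (b Vec.∷ s))
    ≡⟨ halves b ⟩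
  1 ∎
  where
  open ≡.≡-Reasoning
  ss : List (Subset n)
  ss = allSubsets n
  same : ∀ b → count ss (λ t → (b Vec.∷ t) ≟ˢ (b Vec.∷ s)) ≡ 1
  same b = ≡.trans (count-⇔ ss (λ t → (b Vec.∷ t) ≟ˢ (b Vec.∷ s)) (_≟ˢ s)
                     (λ _ → Vec.∷-injectiveʳ) (λ _ → ≡.cong (b Vec.∷_)))
                   (allSubsets-enumerates n s)
  different : ∀ b c → b ≢ c → count ss (λ t → (b Vec.∷ t) ≟ˢ (c Vec.∷ s)) ≡ 0
  different b c b≢c = count-none ss (λ t → (b Vec.∷ t) ≟ˢ (c Vec.∷ s)) (λ _ → b≢c ∘ Vec.∷-injectiveˡ)
  halves : ∀ b → count ss (λ t → (outside Vec.∷ t) ≟ˢ (b Vec.∷ s))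
           + count ss (λ t → (inside Vec.∷ t) ≟ˢ (b Vec.∷ s)) ≡ 1
  halves outside = ≡.cong₂ _+_ (same outside) (different inside outside (λ ()))
  halves inside  = ≡.cong₂ _+_ (different outside inside (λ ())) (same inside)

module SubspaceProperties {q a ℓ₁ ℓ₂} (F : FiniteField q a ℓ₁ ℓ₂) {N m ℓm}
    (𝒱 : VectorSpace F N m ℓm) where
  open Subspaces F 𝒱
  open VectorSpace 𝒱
  private
    module F = FiniteField F
    module 𝔽 = Finite F.size
    module 𝕍 = Finite size
    module R = CommutativeRing (fieldRing F.heytingField)
    module MS = CommutativeSemigroupProperties (CommutativeMonoid.commutativeSemigroup +ᴹ-commutativeMonoid)
    module MG = AbelianGroupProperties +ᴹ-abelianGroup
    open SetoidReasoning ≈ᴹ-setoid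

  1<q : 1 < q
  1<q = F.1<q

  vecs : List Carrierᴹ
  vecs = elements size

  vecs-enumerates : Enumerates 𝕍._≈?_ vecs
  vecs-enumerates = elements-enumerates size

  module Vecs = Enumeration 𝕍._≈?_ vecs vecs-enumerates

  subspaces-enumerates : Enumerates _≟_ subspaces
  subspaces-enumerates W@(subspace w w-subspace) = ≡.trans
    (total-collect isSubspace? subspace (λ U → 𝟙 (U ≟ W)) (λ s → 𝟙 (s ≟ˢ w))
      (λ s p → 𝟙-⇔ (subspace s p ≟ W) (s ≟ˢ w) (λ { refl → refl }) (λ { refl → refl })) sets)
    (≡.trans (total-cong sets (λ s → ≡.sym (𝟙-× (isSubspace? s) (s ≟ˢ w))))
      (≡.trans (count-⇔ sets (λ s → isSubspace? s ×-dec (s ≟ˢ w)) (_≟ˢ w) (λ _ → proj₂)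
                 -- The irrelevant proof stored in `W` is recovered by deciding the property anew.
                 (λ { s refl → recompute (isSubspace? w) w-subspace , refl }))
               (allSubsets-enumerates _ w)))
    where
    sets : List VectorSet
    sets = allSubsets (q ^ N)

  module Subs = Enumeration _≟_ subspaces subspaces-enumerates

  infix 4 _∈_ _∉_ _∈?_
  _∈_ _∉_ : Carrierᴹ → Subspace → Set
  v ∈ U = v ∈ᵥ vectors U
  v ∉ U = ¬ v ∈ U

  _∈?_ : B.Decidable _∈_
  v ∈? U = v ∈ᵥ? vectors U

  isSub : ∀ U → IsSubspace (vectors U)
  isSub (subspace s p) = recompute (isSubspace? s) p

  ∈-resp : ∀ U {v w} → v ≈ᴹ w → v ∈ U → w ∈ U
  ∈-resp U = ∈ᵥ-resp {vectors U}

  0∈ : ∀ U → 0ᴹ ∈ U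
  0∈ U = IsSubspace.0-closed (isSub U)

  +-∈ : ∀ U {v w} → v ∈ U → w ∈ U → v +ᴹ w ∈ U
  +-∈ U v∈ w∈ = IsSubspace.+-closed (isSub U) _ v∈ _ w∈

  *-∈ : ∀ U c {v} → v ∈ U → c *ₗ v ∈ U
  *-∈ U c v∈ = IsSubspace.*-closed (isSub U) c _ v∈

  -1*≈- : ∀ v → (R.- R.1#) *ₗ v ≈ᴹ -ᴹ v
  -1*≈- v = MG.inverseˡ-unique _ v (begin
    (R.- R.1#) *ₗ v +ᴹ v          ≈⟨ +ᴹ-congˡ (*ₗ-identityˡ v) ⟨
    (R.- R.1#) *ₗ v +ᴹ R.1# *ₗ v  ≈⟨ *ₗ-distribʳ v _ _ ⟨
    (R.- R.1# R.+ R.1#) *ₗ v      ≈⟨ *ₗ-congʳ (R.-‿inverseˡ R.1#) ⟩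
    R.0# *ₗ v                     ≈⟨ *ₗ-zeroˡ v ⟩
    0ᴹ                            ∎)

  neg-∈ : ∀ U {v} → v ∈ U → -ᴹ v ∈ U
  neg-∈ U v∈ = ∈-resp U (-1*≈- _) (*-∈ U _ v∈)

  cancel : ∀ v w → -ᴹ v +ᴹ (v +ᴹ w) ≈ᴹ w
  cancel v w = begin
    -ᴹ v +ᴹ (v +ᴹ w)   ≈⟨ +ᴹ-assoc _ v w ⟨
    (-ᴹ v +ᴹ v) +ᴹ w   ≈⟨ +ᴹ-congʳ (-ᴹ‿inverseˡ v) ⟩
    0ᴹ +ᴹ w            ≈⟨ +ᴹ-identityˡ w ⟩
    w                  ∎

  cancel′ : ∀ v w → v +ᴹ (-ᴹ v +ᴹ w) ≈ᴹ w
  cancel′ v w = begin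
    v +ᴹ (-ᴹ v +ᴹ w)   ≈⟨ +ᴹ-assoc v _ w ⟨
    (v +ᴹ -ᴹ v) +ᴹ w   ≈⟨ +ᴹ-congʳ (-ᴹ‿inverseʳ v) ⟩
    0ᴹ +ᴹ w            ≈⟨ +ᴹ-identityˡ w ⟩
    w                  ∎

  +-cancelˡ-≈ : ∀ u {v w} → u +ᴹ v ≈ᴹ u +ᴹ w → v ≈ᴹ w
  +-cancelˡ-≈ u {v} {w} eq = ≈ᴹ-trans (≈ᴹ-sym (cancel u v)) (≈ᴹ-trans (+ᴹ-congˡ eq) (cancel u w))

  +-cancelˡ-∈ : ∀ U {v w} → v ∈ U → v +ᴹ w ∈ U → w ∈ U
  +-cancelˡ-∈ U {v} {w} v∈ v+w∈ = ∈-resp U (cancel v w) (+-∈ U (neg-∈ U v∈) v+w∈)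

  +-cancelʳ-∈ : ∀ U {v w} → w ∈ U → v +ᴹ w ∈ U → v ∈ U
  +-cancelʳ-∈ U w∈ v+w∈ = +-cancelˡ-∈ U w∈ (∈-resp U (+ᴹ-comm _ _) v+w∈)

  -- A Heyting field inverts only what is apart from `0#`. If no inverse existed, `c` could not be
  -- apart from `0#`, and tightness would make it equal to `0#`; as the field is finite, existence
  -- of an inverse is decidable and the double negation can be removed.
  nonzero⇒invertible : ∀ c → ¬ c R.≈ R.0# → ∃ λ d → d R.* c R.≈ R.1#
  nonzero⇒invertible c c≉0 = decidable-stable
    (𝔽.∃? (λ d≈ eq → R.trans (R.*-congʳ (R.sym d≈)) eq) (λ d → (d R.* c) 𝔽.≈? R.1#))
    (λ ∄ → c≉0 (proj₁ (HeytingField.tight F.heytingField c R.0#) (λ c#0 →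
      let d , dc≈1 , _ = HeytingField.#⇒invertible F.heytingField c#0 in
      ∄ (d , R.trans (R.*-congˡ (R.sym (FieldProperties.x-0≈x F.heytingField c))) dc≈1))))

  *-cancel-∈ : ∀ U c {v} → ¬ c R.≈ R.0# → c *ₗ v ∈ U → v ∈ U
  *-cancel-∈ U c {v} c≉0 cv∈ with d , dc≈1 ← nonzero⇒invertible c c≉0 =
    ∈-resp U (≈ᴹ-trans (≈ᴹ-sym (*ₗ-assoc d c v)) (≈ᴹ-trans (*ₗ-congʳ dc≈1) (*ₗ-identityˡ v)))
           (*-∈ U d cv∈)

  -- Inclusion as a record, so that U and W can be inferred from a proof.
  infix 4 _≼_
  record _≼_ (U W : Subspace) : Set m where
    constructor incl
    field app : ∀ {v} → v ∈ U → v ∈ W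
  open _≼_ public

  ⊆⇒≼ : ∀ {U W} → U ⊆ W → U ≼ W
  ⊆⇒≼ U⊆W = incl U⊆W

  ≼⇒⊆ : ∀ {U W} → U ≼ W → U ⊆ W
  ≼⇒⊆ {U} {W} U≼W {i} i∈ = ≡.subst (Subset._∈ vectors W) eq
    (app U≼W {Inverse.from size i} (≡.subst (Subset._∈ vectors U) (≡.sym eq) i∈))
    where
    eq : Inverse.to size (Inverse.from size i) ≡ i
    eq = Inverse.inverseˡ size ≈ᴹ-refl

  infix 4 _≼?_
  _≼?_ : B.Decidable _≼_
  U ≼? W = map′ (⊆⇒≼ {U} {W}) (≼⇒⊆ {U} {W}) (U ⊆? W)

  ≼-refl : ∀ {U} → U ≼ U
  ≼-refl = incl id

  ≼-trans : ∀ {U W X} → U ≼ W → W ≼ X → U ≼ X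
  ≼-trans (incl f) (incl g) = incl (g ∘ f)

  ≼-antisym : ∀ {U W} → U ≼ W → W ≼ U → U ≡ W
  ≼-antisym {U} {W} U≼W W≼U = equal U W (Subset.⊆-antisym (≼⇒⊆ {U} {W} U≼W) (≼⇒⊆ {W} {U} W≼U))
    where
    equal : ∀ U W → vectors U ≡ vectors W → U ≡ W
    equal (subspace _ _) (subspace _ _) refl = refl

  ≼-reflexive : ∀ {U W} → U ≡ W → U ≼ W
  ≼-reflexive refl = incl id

  -- Constructively valid because the search for a witness runs through a finite space.
  ⋠⇒∃∉ : ∀ {U W} → ¬ U ≼ W → ∃ λ v → v ∈ U × v ∉ W
  ⋠⇒∃∉ {U} {W} U⋠W = decidable-stable
    (𝕍.∃? (λ v≈ (v∈ , v∉) → ∈-resp U v≈ v∈ , v∉ ∘ ∈-resp W (≈ᴹ-sym v≈))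
          (λ v → (v ∈? U) ×-dec ¬? (v ∈? W)))
    (λ ∄ → U⋠W (incl λ {v} v∈ → decidable-stable (v ∈? W) (λ v∉ → ∄ (v , v∈ , v∉))))

  ∩-∈ : ∀ U W {v} → v ∈ U → v ∈ W → v ∈ U ∩ W
  ∩-∈ U W v∈U v∈W = Subset.x∈p∩q⁺ (v∈U , v∈W)

  ∩-≼ˡ : ∀ U W → U ∩ W ≼ U
  ∩-≼ˡ U W = incl λ i∈ → proj₁ (Subset.x∈p∩q⁻ (vectors U) (vectors W) i∈)

  ∩-≼ʳ : ∀ U W → U ∩ W ≼ W
  ∩-≼ʳ U W = incl λ i∈ → proj₂ (Subset.x∈p∩q⁻ (vectors U) (vectors W) i∈)

  ∩-greatest : ∀ {U W X} → X ≼ U → X ≼ W → X ≼ U ∩ W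
  ∩-greatest {U} {W} X≼U X≼W = incl λ i∈ → ∩-∈ U W (app X≼U i∈) (app X≼W i∈)

  -- A set of vectors is stored by indices, so the predicate is tabulated on the representatives
  -- `from i`; `resp` carries it between a vector and the representative of its index.
  module Comprehension {p} {P : Pred Carrierᴹ p} (resp : P B.Respects _≈ᴹ_) (P? : Decidable P) where

    abstract

      set : VectorSet
      set = Vec.tabulate (does ∘ P? ∘ Inverse.from size)

      ∈-intro : ∀ v → P v → v ∈ᵥ set
      ∈-intro v Pv = Vec.lookup⇒[]= _ set (≡.trans (Vec.lookup∘tabulate _ (Inverse.to size v))
        (dec-true (P? _) (resp (≈ᴹ-sym (Inverse.inverseʳ size refl)) Pv)))

      ∈-elim : ∀ v → v ∈ᵥ set → P v
      ∈-elim v v∈ with P? (Inverse.from size (Inverse.to size v))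
                     | ≡.trans (≡.sym (Vec.lookup∘tabulate (does ∘ P? ∘ Inverse.from size) (Inverse.to size v)))
                               (Vec.[]=⇒lookup v∈)
      ... | yes p | _ = resp (Inverse.inverseʳ size refl) p
      ... | no _  | ()

  module Zero = Comprehension {P = _≈ᴹ 0ᴹ} (λ v≈w v≈0 → ≈ᴹ-trans (≈ᴹ-sym v≈w) v≈0) (𝕍._≈? 0ᴹ)

  0ˢ : Subspace
  0ˢ = subspace Zero.set record
    { 0-closed = Zero.∈-intro _ ≈ᴹ-refl
    ; +-closed = λ v v∈ w w∈ → Zero.∈-intro _
        (≈ᴹ-trans (+ᴹ-cong (Zero.∈-elim v v∈) (Zero.∈-elim w w∈)) (+ᴹ-identityˡ _))
    ; *-closed = λ c v v∈ → Zero.∈-intro _ (≈ᴹ-trans (*ₗ-congˡ (Zero.∈-elim v v∈)) (*ₗ-zeroʳ c))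
    }

  module Span (v : Carrierᴹ) = Comprehension {P = λ w → ∃ λ c → w ≈ᴹ c *ₗ v}
    (λ w≈ (c , eq) → c , ≈ᴹ-trans (≈ᴹ-sym w≈) eq)
    (λ w → 𝔽.∃? (λ c≈ eq → ≈ᴹ-trans eq (*ₗ-congʳ c≈)) (λ c → w 𝕍.≈? (c *ₗ v)))

  ⟨_⟩ : Carrierᴹ → Subspace
  ⟨ v ⟩ = subspace (Span.set v) record
    { 0-closed = Span.∈-intro v _ (R.0# , ≈ᴹ-sym (*ₗ-zeroˡ v))
    ; +-closed = λ u u∈ w w∈ → let c , eq = Span.∈-elim v u u∈ ; d , eq′ = Span.∈-elim v w w∈ in
        Span.∈-intro v _ (c R.+ d , ≈ᴹ-trans (+ᴹ-cong eq eq′) (≈ᴹ-sym (*ₗ-distribʳ v c d)))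
    ; *-closed = λ c u u∈ → let d , eq = Span.∈-elim v u u∈ in
        Span.∈-intro v _ (c R.* d , ≈ᴹ-trans (*ₗ-congˡ eq) (≈ᴹ-sym (*ₗ-assoc c d v)))
    }

  module Sum (U W : Subspace) = Comprehension {P = λ s → ∃ λ u → ∃ λ w → u ∈ U × w ∈ W × s ≈ᴹ u +ᴹ w}
    (λ s≈ (u , w , u∈ , w∈ , eq) → u , w , u∈ , w∈ , ≈ᴹ-trans (≈ᴹ-sym s≈) eq)
    (λ s → 𝕍.∃? (λ u≈ (w , u∈ , w∈ , eq) → w , ∈-resp U u≈ u∈ , w∈ , ≈ᴹ-trans eq (+ᴹ-congʳ u≈))
      (λ u → 𝕍.∃? (λ w≈ (u∈ , w∈ , eq) → u∈ , ∈-resp W w≈ w∈ , ≈ᴹ-trans eq (+ᴹ-congˡ w≈))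
        (λ w → (u ∈? U) ×-dec (w ∈? W) ×-dec (s 𝕍.≈? (u +ᴹ w)))))

  infixr 6 _⊕_
  _⊕_ : Subspace → Subspace → Subspace
  U ⊕ W = subspace (Sum.set U W) record
    { 0-closed = Sum.∈-intro U W _ (0ᴹ , 0ᴹ , 0∈ U , 0∈ W , ≈ᴹ-sym (+ᴹ-identityˡ 0ᴹ))
    ; +-closed = λ s s∈ t t∈ →
        let u , w , u∈ , w∈ , eq = Sum.∈-elim U W s s∈
            u′ , w′ , u′∈ , w′∈ , eq′ = Sum.∈-elim U W t t∈ in
        Sum.∈-intro U W _ (u +ᴹ u′ , w +ᴹ w′ , +-∈ U u∈ u′∈ , +-∈ W w∈ w′∈ ,
          ≈ᴹ-trans (+ᴹ-cong eq eq′) (MS.interchange u w u′ w′))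
    ; *-closed = λ c s s∈ → let u , w , u∈ , w∈ , eq = Sum.∈-elim U W s s∈ in
        Sum.∈-intro U W _ (c *ₗ u , c *ₗ w , *-∈ U c u∈ , *-∈ W c w∈ ,
          ≈ᴹ-trans (*ₗ-congˡ eq) (*ₗ-distribˡ c u w))
    }

  ⊕-∈ : ∀ U W {u w} → u ∈ U → w ∈ W → u +ᴹ w ∈ U ⊕ W
  ⊕-∈ U W u∈ w∈ = Sum.∈-intro U W _ (_ , _ , u∈ , w∈ , ≈ᴹ-refl)

  ⊕-≼ˡ : ∀ U W → U ≼ U ⊕ W
  ⊕-≼ˡ U W = incl λ v∈ → ∈-resp (U ⊕ W) (+ᴹ-identityʳ _) (⊕-∈ U W v∈ (0∈ W))

  ⊕-≼ʳ : ∀ U W → W ≼ U ⊕ W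
  ⊕-≼ʳ U W = incl λ v∈ → ∈-resp (U ⊕ W) (+ᴹ-identityˡ _) (⊕-∈ U W (0∈ U) v∈)

  ⊕-least : ∀ {U W X} → U ≼ X → W ≼ X → U ⊕ W ≼ X
  ⊕-least {U} {W} {X} U≼X W≼X = incl λ {s} s∈ →
    let u , w , u∈ , w∈ , eq = Sum.∈-elim U W s s∈ in
    ∈-resp X (≈ᴹ-sym eq) (+-∈ X (app U≼X u∈) (app W≼X w∈))

  ∈⟨⟩ : ∀ v → v ∈ ⟨ v ⟩
  ∈⟨⟩ v = Span.∈-intro v v (R.1# , ≈ᴹ-sym (*ₗ-identityˡ v))

  ⟨⟩-least : ∀ {v} U → v ∈ U → ⟨ v ⟩ ≼ U
  ⟨⟩-least {v} U v∈ = incl λ {w} w∈ → let c , eq = Span.∈-elim v w w∈ in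
    ∈-resp U (≈ᴹ-sym eq) (*-∈ U c v∈)

  ∈⊕⟨⟩ : ∀ U v → v ∈ U ⊕ ⟨ v ⟩
  ∈⊕⟨⟩ U v = app (⊕-≼ʳ U ⟨ v ⟩) (∈⟨⟩ v)

  -- In the second alternative `c` can be divided out, so that `v` lies in every subspace containing
  -- both `U` and `s`.
  ⊕⟨⟩-elim : ∀ U v {s} → s ∈ U ⊕ ⟨ v ⟩ →
    s ∈ U ⊎ (∃ λ u → ∃ λ c → u ∈ U × ¬ c R.≈ R.0# × s ≈ᴹ u +ᴹ c *ₗ v)
  ⊕⟨⟩-elim U v {s} s∈ =
    let u , w , u∈ , w∈ , eq = Sum.∈-elim U ⟨ v ⟩ s s∈
        c , w≈cv = Span.∈-elim v w w∈
    in split u c u∈ (≈ᴹ-trans eq (+ᴹ-congˡ w≈cv)) (c 𝔽.≈? R.0#)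
    where
    split : ∀ u c → u ∈ U → s ≈ᴹ u +ᴹ c *ₗ v → Dec (c R.≈ R.0#) →
      s ∈ U ⊎ (∃ λ u → ∃ λ c → u ∈ U × ¬ c R.≈ R.0# × s ≈ᴹ u +ᴹ c *ₗ v)
    split u c u∈ eq (yes c≈0) = inj₁ (∈-resp U (≈ᴹ-sym (≈ᴹ-trans eq (≈ᴹ-trans
      (+ᴹ-congˡ (≈ᴹ-trans (*ₗ-congʳ c≈0) (*ₗ-zeroˡ v))) (+ᴹ-identityʳ u)))) u∈)
    split u c u∈ eq (no c≉0)  = inj₂ (u , c , u∈ , c≉0 , eq)

  -- The nontrivial half of Dedekind's modular law: if `u` and `u + w` lie in `X`, so does `w`.
  modular : ∀ {U X} W → U ≼ X → (U ⊕ W) ∩ X ≼ U ⊕ (W ∩ X)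
  modular {U} {X} W U≼X = incl λ {s} s∈ →
    let u , w , u∈ , w∈ , eq = Sum.∈-elim U W s (app (∩-≼ˡ (U ⊕ W) X) s∈)
        w∈X = +-cancelˡ-∈ X (app U≼X u∈) (∈-resp X eq (app (∩-≼ʳ (U ⊕ W) X) s∈))
    in ∈-resp (U ⊕ (W ∩ X)) (≈ᴹ-sym eq) (⊕-∈ U (W ∩ X) u∈ (∩-∈ W X w∈ w∈X))

  -- Cardinality and dimension

  card : Subspace → ℕ
  card U = count vecs (_∈? U)

  combination-∈ : ∀ U {d} (c : Vector R.Carrier d) b → (∀ j → b j ∈ U) → combination c b ∈ U
  combination-∈ U {zero}  c b b∈ = 0∈ U
  combination-∈ U {suc d} c b b∈ =
    +-∈ U (*-∈ U (c zero) (b∈ zero)) (combination-∈ U (c ∘ suc) (b ∘ suc) (b∈ ∘ suc))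

  -- Coordinates: a family of scalars gives one vector, and by independence a vector of `U` comes
  -- from only one family.
  hasDim⇒card : ∀ U {d} → HasDim U d → card U ≡ q ^ d
  hasDim⇒card U {d} (b , isBasisᵇ) = ≡.sym (≡.trans (≡.sym (count-elements sizeᵈ))
    (≡.trans (≡.sym (ℕ.*-identityˡ _)) (≡.trans (double-count (elements sizeᵈ) vecs
      {R = λ c v → v ≈ᴹ combination c b} {P = λ _ → ⊤}
      (λ c v → v 𝕍.≈? combination c b) (λ _ → yes tt) (_∈? U) 1 1
      (λ c _ → vecs-enumerates (combination c b)) (λ _ _ _ → tt)
      (λ v v∈ → let c , eq = spanning v v∈ in
         Enumeration.count-unique (Finite._≈?_ sizeᵈ) (elements sizeᵈ) (elements-enumerates sizeᵈ)
         (λ c → v 𝕍.≈? combination c b) c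
         (λ c′ c′≈c → ≈ᴹ-trans eq (combination-cong (λ j → R.sym (c′≈c j)) (λ _ → ≈ᴹ-refl)))
         (λ c′ eq′ → combination-injective isBasisᵇ c′ c (≈ᴹ-trans (≈ᴹ-sym eq′) eq)))
      (λ c v v≈ → ∈-resp U (≈ᴹ-sym v≈) (combination-∈ U c b member))) (ℕ.*-identityˡ _))))
    where
    open IsBasis isBasisᵇ
    sizeᵈ = families-size F.size d

  hasDim-0ˢ : HasDim 0ˢ 0
  hasDim-0ˢ = (λ ()) , record
    { member      = λ ()
    ; independent = λ _ _ ()
    ; spanning    = λ v v∈ → (λ ()) , Zero.∈-elim v v∈
    }

  hasDim-⊕⟨⟩ : ∀ U {d} v → HasDim U d → v ∉ U → HasDim (U ⊕ ⟨ v ⟩) (suc d)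
  hasDim-⊕⟨⟩ U {d} v (b , isBasisᵇ) v∉ = b′ , record
    { member      = member′
    ; independent = λ c eq → independent′ c eq (c zero 𝔽.≈? R.0#)
    ; spanning    = spanning′
    }
    where
    open IsBasis isBasisᵇ
    b′ : Vector Carrierᴹ (suc d)
    b′ zero    = v
    b′ (suc j) = b j
    member′ : ∀ j → b′ j ∈ U ⊕ ⟨ v ⟩
    member′ zero    = ∈⊕⟨⟩ U v
    member′ (suc j) = app (⊕-≼ˡ U ⟨ v ⟩) (member j)
    independent′ : ∀ c → combination c b′ ≈ᴹ 0ᴹ → Dec (c zero R.≈ R.0#) → ∀ j → c j R.≈ R.0#
    -- A nonzero coefficient of `v` could be divided out and would put `v` into `U`.
    independent′ c eq (no c≉0) = contradiction
      (*-cancel-∈ U (c zero) c≉0 (+-cancelʳ-∈ U (combination-∈ U (c ∘ suc) b member)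
        (∈-resp U (≈ᴹ-sym eq) (0∈ U)))) v∉
    independent′ c eq (yes c≈0) zero    = c≈0
    independent′ c eq (yes c≈0) (suc j) = independent (c ∘ suc) (≈ᴹ-trans (≈ᴹ-sym
      (≈ᴹ-trans (+ᴹ-congʳ (≈ᴹ-trans (*ₗ-congʳ c≈0) (*ₗ-zeroˡ v))) (+ᴹ-identityˡ _))) eq) j
    spanning′ : ∀ s → s ∈ U ⊕ ⟨ v ⟩ → ∃ λ c → s ≈ᴹ combination c b′
    spanning′ s s∈ =
      let u , w , u∈ , w∈ , eq = Sum.∈-elim U ⟨ v ⟩ s s∈
          c , w≈ = Span.∈-elim v w w∈
          c′ , u≈ = spanning u u∈
      in (λ { zero → c ; (suc j) → c′ j }) ,
         ≈ᴹ-trans eq (≈ᴹ-trans (+ᴹ-cong u≈ w≈) (+ᴹ-comm _ _))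

  -- A basis grows one vector at a time from the zero subspace. The invariant `N < fuel + d` makes
  -- the fuel sufficient, since `hasDim⇒≤` bounds every dimension by `N`.
  ∃-hasDim : ∀ U → ∃ (HasDim U)
  ∃-hasDim U = grow (suc N) 0ˢ 0 hasDim-0ˢ
      (incl λ v∈ → ∈-resp U (≈ᴹ-sym (Zero.∈-elim _ v∈)) (0∈ U))
      (ℕ.≤-reflexive (≡.sym (ℕ.+-identityʳ (suc N))))
    where
    grow : ∀ fuel W d → HasDim W d → W ≼ U → N < fuel + d → ∃ (HasDim U)
    grow zero       W d W-dim W≼U N<d = contradiction (hasDim⇒≤ W W-dim) (ℕ.<⇒≱ N<d)
    grow (suc fuel) W d W-dim W≼U N<  with U ≼? W
    ... | yes U≼W = d , ≡.subst (λ X → HasDim X d) (≼-antisym W≼U U≼W) W-dim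
    ... | no U⋠W with v , v∈U , v∉W ← ⋠⇒∃∉ U⋠W =
      grow fuel (W ⊕ ⟨ v ⟩) (suc d) (hasDim-⊕⟨⟩ W v W-dim v∉W)
        (⊕-least W≼U (⟨⟩-least U v∈U))
        (≡.subst (N <_) (≡.sym (ℕ.+-suc fuel d)) N<)

  abstract

    dim : Subspace → ℕ
    dim U = proj₁ (∃-hasDim U)

    hasDim-dim : ∀ U → HasDim U (dim U)
    hasDim-dim U = proj₂ (∃-hasDim U)

  card≡q^dim : ∀ U → card U ≡ q ^ dim U
  card≡q^dim U = hasDim⇒card U (hasDim-dim U)

  -- Uniqueness of dimension without an exchange argument: the number of vectors is `q ^ d`, and
  -- `q > 1` makes the exponent unique.
  hasDim⇒dim : ∀ U {d} → HasDim U d → dim U ≡ d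
  hasDim⇒dim U h = ^-injective 1<q (≡.trans (≡.sym (card≡q^dim U)) (hasDim⇒card U h))

  dim⇒hasDim : ∀ U {d} → dim U ≡ d → HasDim U d
  dim⇒hasDim U refl = hasDim-dim U

  dim-⊕⟨⟩ : ∀ U {v} → v ∉ U → dim (U ⊕ ⟨ v ⟩) ≡ suc (dim U)
  dim-⊕⟨⟩ U {v} v∉ = hasDim⇒dim (U ⊕ ⟨ v ⟩) (hasDim-⊕⟨⟩ U v (hasDim-dim U) v∉)

  dim-mono : ∀ {U W} → U ≼ W → dim U ≤ dim W
  dim-mono {U} {W} U≼W = ^-reflects-≤ 1<q (≡.subst₂ _≤_ (card≡q^dim U) (card≡q^dim W)
    (count-mono vecs (_∈? U) (_∈? W) (λ _ → app U≼W)))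

  ≼∧dim≥⇒≡ : ∀ {U W} → U ≼ W → dim W ≤ dim U → U ≡ W
  ≼∧dim≥⇒≡ {U} {W} U≼W dW≤dU = ≼-antisym U≼W (decidable-stable (W ≼? U) λ W⋠U →
    let v , v∈W , v∉U = ⋠⇒∃∉ W⋠U in
    ℕ.<⇒≱ (≡.subst (_≤ dim W) (dim-⊕⟨⟩ U v∉U) (dim-mono (⊕-least U≼W (⟨⟩-least W v∈W)))) dW≤dU)

  module _ {p} {P : Pred Carrierᴹ p} (resp : P B.Respects _≈ᴹ_) (P? : Decidable P) where

    Shifted : Carrierᴹ → Pred Carrierᴹ _
    Shifted u s = ∃ λ w → P w × s ≈ᴹ u +ᴹ w

    shifted? : ∀ u → Decidable (Shifted u)
    shifted? u s = 𝕍.∃? (λ w≈ (Pw , eq) → resp w≈ Pw , ≈ᴹ-trans eq (+ᴹ-congˡ w≈))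
                        (λ w → P? w ×-dec (s 𝕍.≈? (u +ᴹ w)))

    -- Translation by `u` is a bijection, expressed as a double count with one pair in each row and
    -- column.
    count-shifted : ∀ u → count vecs (shifted? u) ≡ count vecs P?
    count-shifted u = ℕ.*-cancelˡ-≡ _ _ 1 (double-count vecs vecs
      {R = λ s w → P w × s ≈ᴹ u +ᴹ w}
      (λ s w → P? w ×-dec (s 𝕍.≈? (u +ᴹ w))) (shifted? u) P? 1 1
      (λ s (w , Pw , eq) → Vecs.count-unique (λ w → P? w ×-dec (s 𝕍.≈? (u +ᴹ w))) w
        (λ w′ w′≈ → resp (≈ᴹ-sym w′≈) Pw , ≈ᴹ-trans eq (+ᴹ-congˡ (≈ᴹ-sym w′≈)))
        (λ w′ (_ , eq′) → +-cancelˡ-≈ u (≈ᴹ-trans (≈ᴹ-sym eq′) eq)))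
      (λ s w h → w , h)
      (λ w Pw → Vecs.count-unique (λ s → P? w ×-dec (s 𝕍.≈? (u +ᴹ w))) (u +ᴹ w)
        (λ s s≈ → Pw , s≈) (λ s → proj₂))
      (λ s w → proj₁))

  -- Pairs of `u` in `U` and `s` in the coset `u + W`. A given `u` has `card W` partners; a given
  -- `s = u₀ + w₀` has as partners the coset `u₀ + (U ∩ W)`.
  card-⊕-∩ : ∀ U W → card W * card U ≡ card (U ∩ W) * card (U ⊕ W)
  card-⊕-∩ U W = double-count vecs vecs
      inRow? (_∈? U) (_∈? U ⊕ W) _ _
      (λ u u∈ → ≡.trans (count-⇔ vecs (inRow? u) (shifted? (∈-resp W) (_∈? W) u) (λ _ → proj₂) (λ _ → u∈ ,_))
                        (count-shifted (∈-resp W) (_∈? W) u))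
      (λ _ _ → proj₁)
      column
      (λ u s (u∈ , w , w∈ , eq) → ∈-resp (U ⊕ W) (≈ᴹ-sym eq) (⊕-∈ U W u∈ w∈))
    where
    inRow? : ∀ u s → Dec (u ∈ U × ∃ λ w → w ∈ W × s ≈ᴹ u +ᴹ w)
    inRow? u s = (u ∈? U) ×-dec shifted? (∈-resp W) (_∈? W) u s
    column : ∀ s → s ∈ U ⊕ W → count vecs (λ u → inRow? u s) ≡ card (U ∩ W)
    column s s∈ with u₀ , w₀ , u₀∈ , w₀∈ , eq₀ ← Sum.∈-elim U W s s∈ = ≡.trans
      (count-⇔ vecs (λ u → inRow? u s) (shifted? (∈-resp (U ∩ W)) (_∈? (U ∩ W)) u₀)
        (λ u (u∈ , w , w∈ , eq) → -ᴹ u₀ +ᴹ u ,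
          ∩-∈ U W (+-∈ U (neg-∈ U u₀∈) u∈)
            (+-cancelʳ-∈ W w∈ (∈-resp W (begin
               w₀                        ≈⟨ cancel u₀ w₀ ⟨
               -ᴹ u₀ +ᴹ (u₀ +ᴹ w₀)       ≈⟨ +ᴹ-congˡ (≈ᴹ-trans (≈ᴹ-sym eq₀) eq) ⟩
               -ᴹ u₀ +ᴹ (u +ᴹ w)         ≈⟨ +ᴹ-assoc _ u w ⟨
               (-ᴹ u₀ +ᴹ u) +ᴹ w         ∎) w₀∈)) ,
          ≈ᴹ-sym (cancel′ u₀ u))
        (λ u (t , t∈ , u≈) →
          ∈-resp U (≈ᴹ-sym u≈) (+-∈ U u₀∈ (app (∩-≼ˡ U W) t∈)) ,
          (-ᴹ t +ᴹ w₀) , +-∈ W (neg-∈ W (app (∩-≼ʳ U W) t∈)) w₀∈ , (begin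
            s                              ≈⟨ eq₀ ⟩
            u₀ +ᴹ w₀                       ≈⟨ +ᴹ-congˡ (cancel′ t w₀) ⟨
            u₀ +ᴹ (t +ᴹ (-ᴹ t +ᴹ w₀))      ≈⟨ +ᴹ-assoc u₀ t _ ⟨
            (u₀ +ᴹ t) +ᴹ (-ᴹ t +ᴹ w₀)      ≈⟨ +ᴹ-congʳ u≈ ⟨
            u +ᴹ (-ᴹ t +ᴹ w₀)              ∎)))
      (count-shifted (∈-resp (U ∩ W)) (_∈? (U ∩ W)) u₀)

  dim-⊕-∩ : ∀ U W → dim W + dim U ≡ dim (U ∩ W) + dim (U ⊕ W)
  dim-⊕-∩ U W = ^-injective 1<q
    (≡.trans (powers W U) (≡.trans (card-⊕-∩ U W) (≡.sym (powers (U ∩ W) (U ⊕ W)))))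
    where
    powers : ∀ X Y → q ^ (dim X + dim Y) ≡ card X * card Y
    powers X Y = ≡.trans (ℕ.^-distribˡ-+-* q (dim X) (dim Y))
                         (≡.sym (≡.cong₂ _*_ (card≡q^dim X) (card≡q^dim Y)))

-- Hyperplanes and neighbours

-- gauss q n is [ n ] as a natural number.
gauss : ℕ → ℕ → ℕ
gauss q zero    = 0
gauss q (suc n) = 1 + q * gauss q n

gauss-suc : ∀ q n → gauss q (suc n) ≡ gauss q n + q ^ n
gauss-suc q zero    = ≡.cong suc (ℕ.*-zeroʳ q)
gauss-suc q (suc n) = ≡.trans (≡.cong (λ t → 1 + q * t) (gauss-suc q n))
  (≡.cong suc (ℕ.*-distribˡ-+ q (gauss q n) (q ^ n)))

-- The defining quotient `[n] = (q ^ n - 1) / (q - 1)`, cleared of division and subtraction.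
^≡1+gauss : ∀ q .{{_ : NonZero q}} n → q ^ n ≡ 1 + pred q * gauss q n
^≡1+gauss (suc p) zero    = ≡.cong suc (≡.sym (ℕ.*-zeroʳ p))
^≡1+gauss (suc p) (suc n) = ≡.trans (≡.cong (suc p *_) (^≡1+gauss (suc p) n))
  (solve 2 (λ p G → (con 1 :+ p) :* (con 1 :+ p :* G) := con 1 :+ p :* (con 1 :+ (con 1 :+ p) :* G))
    refl p (gauss (suc p) n))

gauss-mono : ∀ q .{{_ : NonZero q}} {m n} → m ≤ n → gauss q m ≤ gauss q n
gauss-mono q z≤n       = z≤n
gauss-mono q (s≤s m≤n) = s≤s (ℕ.*-monoʳ-≤ q (gauss-mono q m≤n))

module Neighbours {q a ℓ₁ ℓ₂} (F : FiniteField q a ℓ₁ ℓ₂) {N m ℓm} (𝒱 : VectorSpace F N m ℓm) where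
  open Subspaces F 𝒱
  open SubspaceProperties F 𝒱
  open VectorSpace 𝒱

  private
    p : ℕ
    p = pred q

    g : ℕ → ℕ
    g = gauss q

    instance
      q-nonZero : NonZero q
      q-nonZero = ℕ.>-nonZero (ℕ.<-trans (s≤s z≤n) 1<q)

      p-nonZero : NonZero p
      p-nonZero = ℕ.>-nonZero (ℕ.pred-mono-≤ 1<q)

  q≡1+p : q ≡ 1 + p
  q≡1+p = ≡.sym (ℕ.suc-pred q)

  -- The difference `q ^ dim W - q ^ dim U` in factored form, so that the factors common to two
  -- counts can be cancelled.
  count-∖ : ∀ {U W} n → U ≼ W → dim U + n ≡ dim W →
    count vecs (λ v → (v ∈? W) ×-dec ¬? (v ∈? U)) ≡ q ^ dim U * (p * g n)
  count-∖ {U} {W} n U≼W eq = ℕ.+-cancelˡ-≡ (q ^ dim U) _ _ (begin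
    q ^ dim U + count vecs (λ v → (v ∈? W) ×-dec ¬? (v ∈? U))
      ≡⟨ ≡.cong (_+ count vecs (λ v → (v ∈? W) ×-dec ¬? (v ∈? U))) (≡.trans (≡.sym (card≡q^dim U))
           (count-⇔ vecs (_∈? U) (λ v → (v ∈? W) ×-dec (v ∈? U)) (λ v v∈ → app U≼W v∈ , v∈) (λ _ → proj₂))) ⟩
    count vecs (λ v → (v ∈? W) ×-dec (v ∈? U)) + count vecs (λ v → (v ∈? W) ×-dec ¬? (v ∈? U))
      ≡⟨ count-split vecs (_∈? W) (_∈? U) ⟨
    card W                          ≡⟨ card≡q^dim W ⟩
    q ^ dim W                       ≡⟨ ≡.cong (q ^_) eq ⟨
    q ^ (dim U + n)                 ≡⟨ ℕ.^-distribˡ-+-* q (dim U) n ⟩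
    q ^ dim U * q ^ n               ≡⟨ ≡.cong (q ^ dim U *_) (^≡1+gauss q n) ⟩
    q ^ dim U * (1 + p * g n)       ≡⟨ ℕ.*-suc (q ^ dim U) (p * g n) ⟩
    q ^ dim U + q ^ dim U * (p * g n) ∎)
    where open ≡.≡-Reasoning

  Hyperplane : Subspace → Subspace → Set _
  Hyperplane z h = h ≼ z × suc (dim h) ≡ dim z

  hyperplane? : ∀ z h → Dec (Hyperplane z h)
  hyperplane? z h = (h ≼? z) ×-dec (suc (dim h) ℕ.≟ dim z)

  hyperplaneOver? : ∀ δ z h → Dec (Hyperplane z h × δ ≼ h)
  hyperplaneOver? δ z h = hyperplane? z h ×-dec (δ ≼? h)

  CountHyperplanesOver : ℕ → Set _
  CountHyperplanesOver d = ∀ {δ z} → δ ≼ z → dim δ + d ≡ dim z →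
    count subspaces (hyperplaneOver? δ z) ≡ g d

  -- Double counting of the pairs (h, u) with u in h outside δ.
  count-hyperplanesOver-suc : ∀ d → CountHyperplanesOver (suc d) → CountHyperplanesOver (suc (suc d))
  count-hyperplanesOver-suc d ih {δ} {z} δ≼z eq = ℕ.*-cancelˡ-≡ _ _ k {{k-nonZero}} (begin
    k * count subspaces (hyperplaneOver? δ z)
      ≡⟨ double-count subspaces vecs R? (hyperplaneOver? δ z) (λ u → (u ∈? z) ×-dec ¬? (u ∈? δ)) k (g (suc d))
           rows (λ h u → proj₁) columns (λ h u (((h≼z , _) , _) , u∈h , u∉δ) → app h≼z u∈h , u∉δ) ⟩
    g (suc d) * count vecs (λ u → (u ∈? z) ×-dec ¬? (u ∈? δ))
      ≡⟨ ≡.cong (g (suc d) *_) (count-∖ (suc (suc d)) δ≼z eq) ⟩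
    g (suc d) * (q ^ dim δ * (p * g (suc (suc d))))
      ≡⟨ shuffle (g (suc d)) (q ^ dim δ) p (g (suc (suc d))) ⟩
    k * g (suc (suc d)) ∎)
    where
    open ≡.≡-Reasoning
    k : ℕ
    k = q ^ dim δ * (p * g (suc d))
    shuffle : ∀ G T p H → G * (T * (p * H)) ≡ T * (p * G) * H
    shuffle = solve 4 (λ G T p H → G :* (T :* (p :* H)) := T :* (p :* G) :* H) refl
    k-nonZero : NonZero k
    k-nonZero = ℕ.m*n≢0 (q ^ dim δ) (p * g (suc d)) {{ℕ.m^n≢0 q (dim δ)}} {{ℕ.m*n≢0 p (g (suc d))}}
    R? : ∀ h u → Dec ((Hyperplane z h × δ ≼ h) × u ∈ h × u ∉ δ)
    R? h u = hyperplaneOver? δ z h ×-dec (u ∈? h) ×-dec ¬? (u ∈? δ)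
    rows : ∀ h → Hyperplane z h × δ ≼ h → count vecs (R? h) ≡ k
    rows h over@((_ , dim-h) , δ≼h) = ≡.trans
      (count-⇔ vecs (R? h) (λ u → (u ∈? h) ×-dec ¬? (u ∈? δ)) (λ _ → proj₂) (λ _ → over ,_))
      (count-∖ {δ} {h} (suc d) δ≼h (ℕ.suc-injective
        (≡.trans (≡.sym (ℕ.+-suc _ (suc d))) (≡.trans eq (≡.sym dim-h)))))
    -- Hyperplanes over `δ` and through `u` are those over `δ ⊕ ⟨ u ⟩`, whose codimension in `z` is
    -- smaller by one.
    columns : ∀ u → u ∈ z × u ∉ δ → count subspaces (λ h → R? h u) ≡ g (suc d)
    columns u (u∈z , u∉δ) = ≡.trans
      (count-⇔ subspaces (λ h → R? h u) (hyperplaneOver? (δ ⊕ ⟨ u ⟩) z)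
        (λ h ((hyp , δ≼h) , u∈h , _) → hyp , ⊕-least δ≼h (⟨⟩-least h u∈h))
        (λ h (hyp , δu≼h) → (hyp , ≼-trans (⊕-≼ˡ δ ⟨ u ⟩) δu≼h) , app δu≼h (∈⊕⟨⟩ δ u) , u∉δ))
      (ih {δ ⊕ ⟨ u ⟩} {z} (⊕-least δ≼z (⟨⟩-least z u∈z))
        (≡.trans (≡.cong (_+ suc d) (dim-⊕⟨⟩ δ u∉δ)) (≡.trans (≡.sym (ℕ.+-suc _ (suc d))) eq)))

  -- The inductive step cancels the factor `g` of the smaller codimension. Since `g 0` is `0`, it
  -- cannot lead from codimension 0 to 1, and codimension 1 is a second base case, where `δ` itself
  -- is the only hyperplane.
  count-hyperplanesOver : ∀ d → CountHyperplanesOver d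
  count-hyperplanesOver zero {δ} {z} δ≼z eq = count-none subspaces (hyperplaneOver? δ z)
    (λ h ((h≼z , dim-h) , δ≼h) → ℕ.<⇒≱ (ℕ.≤-reflexive dim-h)
      (≡.subst (_≤ dim h) (≡.trans (≡.sym (ℕ.+-identityʳ _)) eq) (dim-mono δ≼h)))
  count-hyperplanesOver (suc zero) {δ} {z} δ≼z eq = ≡.trans
    (Subs.count-unique (hyperplaneOver? δ z) δ
      (λ { h refl → (δ≼z , ≡.trans (ℕ.+-comm 1 (dim δ)) eq) , ≼-refl })
      (λ h ((_ , dim-h) , δ≼h) → ≡.sym (≼∧dim≥⇒≡ δ≼h
        (ℕ.≤-reflexive (ℕ.suc-injective (≡.trans dim-h (≡.trans (≡.sym eq) (ℕ.+-comm (dim δ) 1))))))))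
    (≡.cong suc (≡.sym (ℕ.*-zeroʳ q)))
  count-hyperplanesOver (suc (suc d)) = count-hyperplanesOver-suc d (count-hyperplanesOver (suc d))

  count-all : count vecs (λ _ → yes tt) ≡ q ^ N
  count-all = count-elements size

  module _ {x z α : Subspace} (dim-x≡dim-z : dim x ≡ dim z) (α≼x : α ≼ x) where

    -- The neighbours of `z` that contribute to the left-hand side at `z`; `dim z` plays the part of
    -- `D`.
    Near : Subspace → Set _
    Near y = dim y ≡ dim z × suc (dim (y ∩ z)) ≡ dim z × y ∩ x ≡ α

    near? : ∀ y → Dec (Near y)
    near? y = (dim y ℕ.≟ dim z) ×-dec (suc (dim (y ∩ z)) ℕ.≟ dim z) ×-dec (y ∩ x ≟ α)

    γ δ : Subspace
    γ = z ∩ x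
    δ = α ∩ γ

    δ≼α : δ ≼ α
    δ≼α = ∩-≼ˡ α γ

    δ≼γ : δ ≼ γ
    δ≼γ = ∩-≼ʳ α γ

    δ≼z : δ ≼ z
    δ≼z = ≼-trans δ≼γ (∩-≼ˡ z x)

    γ≼z : γ ≼ z
    γ≼z = ∩-≼ˡ z x

    γ≼x : γ ≼ x
    γ≼x = ∩-≼ʳ z x

    Meet : Subspace → Set _
    Meet h = Hyperplane z h × h ∩ x ≡ δ

    meet? : ∀ h → Dec (Meet h)
    meet? h = hyperplane? z h ×-dec (h ∩ x ≟ δ)

    -- `(y ∩ z) ∩ x` is `(y ∩ x) ∩ (z ∩ x)`, that is, `α ∩ γ`.
    near⇒meet : ∀ y → Near y → Meet (y ∩ z)
    near⇒meet y (_ , dim-y∩z , y∩x≡α) = (∩-≼ʳ y z , dim-y∩z) , ≼-antisym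
      (∩-greatest
        (≼-trans (∩-greatest (≼-trans y∩z∩x≼y∩z (∩-≼ˡ y z)) (∩-≼ʳ (y ∩ z) x)) (≼-reflexive y∩x≡α))
        (∩-greatest (≼-trans y∩z∩x≼y∩z (∩-≼ʳ y z)) (∩-≼ʳ (y ∩ z) x)))
      (∩-greatest
        (∩-greatest (≼-trans δ≼α (≼-trans (≼-reflexive (≡.sym y∩x≡α)) (∩-≼ˡ y x))) δ≼z)
        (≼-trans δ≼γ γ≼x))
      where
      y∩z∩x≼y∩z : (y ∩ z) ∩ x ≼ y ∩ z
      y∩z∩x≼y∩z = ∩-≼ˡ (y ∩ z) x

    nearThrough? : ∀ h y → Dec (Near y × y ∩ z ≡ h)
    nearThrough? h y = near? y ×-dec (y ∩ z ≟ h)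

    -- The map `y ↦ y ∩ z` sends near subspaces to hyperplanes with `Meet`, and `k` is the size of
    -- each of its fibres.
    count-near : ∀ k → (∀ h → Meet h → count subspaces (nearThrough? h) ≡ k) →
      count subspaces near? ≡ k * count subspaces meet?
    count-near k through = ≡.trans (≡.sym (ℕ.*-identityˡ _))
      (double-count subspaces subspaces (λ y h → nearThrough? h y) near? meet? 1 k
        (λ y near → Subs.count-unique (λ h → nearThrough? h y) (y ∩ z)
          (λ { h refl → near , refl }) (λ h → ≡.sym ∘ proj₂))
        (λ y h → proj₁) through (λ { y h (near , refl) → near⇒meet y near }))

    -- A hyperplane `h` of `z` has `h ∩ x` inside `γ`; once it contains `γ = δ`, equality follows.
    meet⇔over : ∀ {δ′} → (∀ h → Hyperplane z h → h ∩ x ≡ δ → δ′ ≼ h) → δ ≡ γ → γ ≼ δ′ →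
      count subspaces meet? ≡ count subspaces (hyperplaneOver? δ′ z)
    meet⇔over {δ′} f δ≡γ γ≼δ′ = count-⇔ subspaces meet? (hyperplaneOver? δ′ z)
      (λ h (hyp , eq) → hyp , f h hyp eq)
      (λ h (hyp , δ′≼h) → hyp , ≼-antisym
        (≼-trans (∩-greatest (≼-trans (∩-≼ˡ h x) (proj₁ hyp)) (∩-≼ʳ h x)) (≼-reflexive (≡.sym δ≡γ)))
        (∩-greatest (≼-trans (≼-reflexive δ≡γ) (≼-trans γ≼δ′ δ′≼h)) (≼-trans δ≼γ γ≼x)))

    count-meet-γ : ∀ d → δ ≡ γ → dim γ + d ≡ dim z → count subspaces meet? ≡ g d
    count-meet-γ d δ≡γ eq = ≡.trans
      (meet⇔over (λ h _ h∩x≡δ → ≼-trans (≼-reflexive (≡.trans (≡.sym δ≡γ) (≡.sym h∩x≡δ))) (∩-≼ˡ h x))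
        δ≡γ ≼-refl)
      (count-hyperplanesOver d γ≼z eq)

    -- For `h` over `δ`, the space `h ∩ x` lies between `δ` and `γ`, which differ by one dimension,
    -- so it is `δ` unless `h` contains `γ`. Subtracting the hyperplanes over `γ` leaves
    -- `[d + 1] - [d]`.
    count-meet-δ : ∀ d → dim γ ≡ suc (dim δ) → dim γ + d ≡ dim z → count subspaces meet? ≡ q ^ d
    count-meet-δ d dim-γ eq = ℕ.+-cancelˡ-≡ (g d) _ _ (begin
      g d + count subspaces meet?
        ≡⟨ ≡.cong₂ _+_
             (≡.trans (≡.sym (count-hyperplanesOver d γ≼z eq))
               (count-⇔ subspaces (hyperplaneOver? γ z) (λ h → hyperplaneOver? δ z h ×-dec (γ ≼? h))
                 (λ h (hyp , γ≼h) → (hyp , ≼-trans δ≼γ γ≼h) , γ≼h) (λ h ((hyp , _) , γ≼h) → hyp , γ≼h)))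
             (count-⇔ subspaces meet? (λ h → hyperplaneOver? δ z h ×-dec ¬? (γ ≼? h)) meet⇒ ⇒meet) ⟩
      count subspaces (λ h → hyperplaneOver? δ z h ×-dec (γ ≼? h))
        + count subspaces (λ h → hyperplaneOver? δ z h ×-dec ¬? (γ ≼? h))
        ≡⟨ count-split subspaces (hyperplaneOver? δ z) (γ ≼?_) ⟨
      count subspaces (hyperplaneOver? δ z)
        ≡⟨ count-hyperplanesOver (suc d) δ≼z
             (≡.trans (ℕ.+-suc (dim δ) d) (≡.trans (≡.cong (_+ d) (≡.sym dim-γ)) eq)) ⟩
      g (suc d) ≡⟨ gauss-suc q d ⟩
      g d + q ^ d ∎)
      where
      open ≡.≡-Reasoning
      meet⇒ : ∀ h → Meet h → (Hyperplane z h × δ ≼ h) × ¬ γ ≼ h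
      meet⇒ h (hyp , h∩x≡δ) = (hyp , ≼-trans (≼-reflexive (≡.sym h∩x≡δ)) (∩-≼ˡ h x)) , λ γ≼h →
        ℕ.<⇒≱ (ℕ.≤-reflexive (≡.sym dim-γ))
              (dim-mono (≼-trans (∩-greatest γ≼h γ≼x) (≼-reflexive h∩x≡δ)))
      ⇒meet : ∀ h → (Hyperplane z h × δ ≼ h) × ¬ γ ≼ h → Meet h
      ⇒meet h ((hyp , δ≼h) , γ⋠h) = hyp , ≡.sym (≼∧dim≥⇒≡ (∩-greatest δ≼h (≼-trans δ≼γ γ≼x))
        (ℕ.≮⇒≥ λ lt → γ⋠h (≼-trans
          (≼-reflexive (≡.sym (≼∧dim≥⇒≡ {h ∩ x} {γ} (∩-greatest (≼-trans (∩-≼ˡ h x) (proj₁ hyp)) (∩-≼ʳ h x))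
            (≡.subst (_≤ dim (h ∩ x)) (≡.sym dim-γ) lt))))
          (∩-≼ˡ h x))))

    -- The only near y through h is α ⊕ h.
    count-nearThrough-δ : dim α ≡ suc (dim δ) → ∀ h → Meet h → count subspaces (nearThrough? h) ≡ 1
    count-nearThrough-δ dim-α h ((h≼z , dim-h) , h∩x≡δ) =
      Subs.count-unique (nearThrough? h) (α ⊕ h)
        (λ { y refl → (dim-y , ≡.trans (≡.cong (suc ∘ dim) y∩z≡h) dim-h , y∩x≡α) , y∩z≡h })
        (λ y ((dim-y′ , _ , y∩x≡α) , y∩z≡h) → ≡.sym (≼∧dim≥⇒≡
          (⊕-least (≼-trans (≼-reflexive (≡.sym y∩x≡α)) (∩-≼ˡ y x))
                   (≼-trans (≼-reflexive (≡.sym y∩z≡h)) (∩-≼ˡ y z)))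
          (ℕ.≤-reflexive (≡.trans dim-y′ (≡.sym dim-y)))))
      where
      δ≼h : δ ≼ h
      δ≼h = ≼-trans (≼-reflexive (≡.sym h∩x≡δ)) (∩-≼ˡ h x)
      α∩h≡δ : α ∩ h ≡ δ
      α∩h≡δ = ≼-antisym
        (≼-trans (∩-greatest (∩-≼ʳ α h) (≼-trans (∩-≼ˡ α h) α≼x)) (≼-reflexive h∩x≡δ))
        (∩-greatest δ≼α δ≼h)
      dim-y : dim (α ⊕ h) ≡ dim z
      dim-y = ℕ.+-cancelˡ-≡ (dim δ) _ _ (begin
        dim δ + dim (α ⊕ h)        ≡⟨ ≡.cong (λ U → dim U + dim (α ⊕ h)) α∩h≡δ ⟨
        dim (α ∩ h) + dim (α ⊕ h)  ≡⟨ dim-⊕-∩ α h ⟨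
        dim h + dim α              ≡⟨ ≡.cong (dim h +_) dim-α ⟩
        dim h + suc (dim δ)        ≡⟨ ℕ.+-suc (dim h) (dim δ) ⟩
        suc (dim h) + dim δ        ≡⟨ ≡.cong (_+ dim δ) dim-h ⟩
        dim z + dim δ              ≡⟨ ℕ.+-comm (dim z) (dim δ) ⟩
        dim δ + dim z              ∎)
        where open ≡.≡-Reasoning
      -- By the modular law the intersection is `h + (α ∩ z)`, and `α ∩ z` lies in `δ` because `α`
      -- lies in `x`.
      y∩z≡h : (α ⊕ h) ∩ z ≡ h
      y∩z≡h = ≼-antisym
        (≼-trans (∩-greatest (≼-trans (∩-≼ˡ (α ⊕ h) z) (⊕-least (⊕-≼ʳ h α) (⊕-≼ˡ h α))) (∩-≼ʳ (α ⊕ h) z))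
          (≼-trans (modular α h≼z) (⊕-least ≼-refl (≼-trans
            (∩-greatest (∩-≼ˡ α z) (∩-greatest (∩-≼ʳ α z) (≼-trans (∩-≼ˡ α z) α≼x))) δ≼h))))
        (∩-greatest (⊕-≼ʳ α h) h≼z)
      y∩x≡α : (α ⊕ h) ∩ x ≡ α
      y∩x≡α = ≼-antisym
        (≼-trans (modular h α≼x) (⊕-least ≼-refl (≼-trans (≼-reflexive h∩x≡δ) δ≼α)))
        (∩-greatest (⊕-≼ˡ α h) α≼x)

    Outside : Subspace → Carrierᴹ → Set
    Outside h v = v ∉ z × v ∉ h ⊕ x

    outside? : ∀ h v → Dec (Outside h v)
    outside? h v = ¬? (v ∈? z) ×-dec ¬? (v ∈? h ⊕ x)

    -- The near y through h are the h ⊕ ⟨ v ⟩ with v outside z and h ⊕ x.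
    count-nearThrough-α : δ ≡ α → ∀ h → Meet h →
      q ^ dim h * p * count subspaces (nearThrough? h) ≡ count vecs (outside? h)
    count-nearThrough-α δ≡α h ((h≼z , dim-h) , h∩x≡δ) = ≡.trans
      (double-count subspaces vecs R? (nearThrough? h) (outside? h) _ 1
        rows (λ _ _ → proj₁) columns R⇒outside)
      (ℕ.*-identityˡ _)
      where
      -- Pairs of `y` and a vector `v` of `y` outside `h`. As `h` is a hyperplane of `y`, each `y`
      -- has `q ^ dim h * p` of them, while `v` and `h` together determine `y`.
      R? : ∀ y v → Dec ((Near y × y ∩ z ≡ h) × v ∈ y × v ∉ h)
      R? y v = nearThrough? h y ×-dec (v ∈? y) ×-dec ¬? (v ∈? h)
      h≼y : ∀ {y} → y ∩ z ≡ h → h ≼ y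
      h≼y {y} eq = ≼-trans (≼-reflexive (≡.sym eq)) (∩-≼ˡ y z)
      rows : ∀ y → Near y × y ∩ z ≡ h → count vecs (R? y) ≡ q ^ dim h * p
      rows y near@((dim-y , _ , _) , y∩z≡h) = ≡.trans
        (count-⇔ vecs (R? y) (λ v → (v ∈? y) ×-dec ¬? (v ∈? h)) (λ _ → proj₂) (λ _ → near ,_))
        (≡.trans (count-∖ 1 (h≼y {y} y∩z≡h) (≡.trans (ℕ.+-comm (dim h) 1) (≡.trans dim-h (≡.sym dim-y))))
          (≡.cong (q ^ dim h *_) (≡.trans (≡.cong (p *_) (≡.cong suc (ℕ.*-zeroʳ q))) (ℕ.*-identityʳ p))))
      R⇒outside : ∀ y v → (Near y × y ∩ z ≡ h) × v ∈ y × v ∉ h → Outside h v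
      R⇒outside y v (((_ , _ , y∩x≡α) , y∩z≡h) , v∈y , v∉h) =
        (λ v∈z → v∉h (app (≼-reflexive y∩z≡h) (∩-∈ y z v∈y v∈z))) ,
        -- By the modular law `(h ⊕ x) ∩ y` is `h + (x ∩ y)`, and `x ∩ y = α = δ` lies in `h`.
        (λ v∈h⊕x → v∉h (app (≼-trans (modular x (h≼y {y} y∩z≡h)) (⊕-least ≼-refl x∩y≼h))
          (∩-∈ (h ⊕ x) y v∈h⊕x v∈y)))
        where
        x∩y≼h : x ∩ y ≼ h
        x∩y≼h = ≼-trans (∩-greatest (∩-≼ʳ x y) (∩-≼ˡ x y)) (≼-trans
          (≼-reflexive (≡.trans y∩x≡α (≡.trans (≡.sym δ≡α) (≡.sym h∩x≡δ)))) (∩-≼ˡ h x))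
      columns : ∀ v → Outside h v → count subspaces (λ y → R? y v) ≡ 1
      columns v (v∉z , v∉h⊕x) = Subs.count-unique (λ y → R? y v) (h ⊕ ⟨ v ⟩)
          (λ { y refl → ((dim-y , ≡.trans (≡.cong (suc ∘ dim) y∩z≡h) dim-h , y∩x≡α) , y∩z≡h)
                      , ∈⊕⟨⟩ h v , v∉h })
          (λ y (((dim-y′ , _) , y∩z≡h) , v∈y , _) → ≡.sym (≼∧dim≥⇒≡
            (⊕-least (h≼y {y} y∩z≡h) (⟨⟩-least y v∈y)) (ℕ.≤-reflexive (≡.trans dim-y′ (≡.sym dim-y)))))
        where
        v∉h : v ∉ h
        v∉h = v∉z ∘ app h≼z
        dim-y : dim (h ⊕ ⟨ v ⟩) ≡ dim z
        dim-y = ≡.trans (dim-⊕⟨⟩ h v∉h) dim-h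
        -- A vector `u + c v` of `X` with `u` in `h` and `c` nonzero would put `v` into `Y`. Used
        -- with `Y = z` for `X = z`, and with `Y = h ⊕ x` for `X = x`.
        y∩≼h : ∀ X Y → h ≼ Y → X ≼ Y → v ∉ Y → (h ⊕ ⟨ v ⟩) ∩ X ≼ h
        y∩≼h X Y h≼Y X≼Y v∉Y = incl λ s∈ →
          [ id
          , (λ (u , c , u∈ , c≉0 , eq) → contradiction (*-cancel-∈ Y c c≉0 (+-cancelˡ-∈ Y (app h≼Y u∈)
              (∈-resp Y eq (app (≼-trans (∩-≼ʳ (h ⊕ ⟨ v ⟩) X) X≼Y) s∈)))) v∉Y) ]′
          (⊕⟨⟩-elim h v (app (∩-≼ˡ (h ⊕ ⟨ v ⟩) X) s∈))
        y∩z≡h : (h ⊕ ⟨ v ⟩) ∩ z ≡ h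
        y∩z≡h = ≼-antisym (y∩≼h z z h≼z ≼-refl v∉z) (∩-greatest (⊕-≼ˡ h ⟨ v ⟩) h≼z)
        y∩x≡α : (h ⊕ ⟨ v ⟩) ∩ x ≡ α
        y∩x≡α = ≡.trans (≼-antisym
          (∩-greatest (y∩≼h x (h ⊕ x) (⊕-≼ˡ h x) (⊕-≼ʳ h x) v∉h⊕x) (∩-≼ʳ (h ⊕ ⟨ v ⟩) x))
          (∩-greatest (≼-trans (∩-≼ˡ h x) (⊕-≼ˡ h ⟨ v ⟩)) (∩-≼ʳ h x))) (≡.trans h∩x≡δ δ≡α)

    -- Inclusion-exclusion for the union of `z` and `h ⊕ x` in the whole space, with the negative
    -- terms moved across.
    count-outside : ∀ h → q ^ dim ((h ⊕ x) ∩ z) + q ^ N ≡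
      q ^ dim z + q ^ dim (h ⊕ x) + count vecs (outside? h)
    count-outside h = begin
      q ^ dim (U ∩ z) + q ^ N            ≡⟨ ≡.cong₂ _+_ (≡.sym (card≡q^dim (U ∩ z))) (≡.sym count-all) ⟩
      card (U ∩ z) + count vecs all?     ≡⟨ ≡.cong₂ _+_ U∩z (count-split vecs all? (_∈? z)) ⟩
      a₁ + (count vecs (λ v → all? v ×-dec (v ∈? z)) + count vecs (λ v → all? v ×-dec ¬? (v ∈? z)))
                                         ≡⟨ ≡.cong₂ (λ s t → a₁ + (s + t)) in-z out-z ⟩
      a₁ + (card z + (a₂ + count vecs (outside? h)))
        ≡⟨ shuffle a₁ (card z) a₂ (count vecs (outside? h)) ⟩
      card z + (a₁ + a₂) + count vecs (outside? h)
        ≡⟨ ≡.cong (λ t → card z + t + count vecs (outside? h)) (count-split vecs (_∈? U) (_∈? z)) ⟨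
      card z + card U + count vecs (outside? h)
        ≡⟨ ≡.cong (_+ count vecs (outside? h)) (≡.cong₂ _+_ (card≡q^dim z) (card≡q^dim U)) ⟩
      q ^ dim z + q ^ dim U + count vecs (outside? h) ∎
      where
      open ≡.≡-Reasoning
      U : Subspace
      U = h ⊕ x
      shuffle : ∀ a b c d → a + (b + (c + d)) ≡ b + (a + c) + d
      shuffle = solve 4 (λ a b c d → a :+ (b :+ (c :+ d)) := b :+ (a :+ c) :+ d) refl
      all? : (v : Carrierᴹ) → Dec ⊤
      all? _ = yes tt
      a₁ a₂ : ℕ
      a₁ = count vecs (λ v → (v ∈? U) ×-dec (v ∈? z))
      a₂ = count vecs (λ v → (v ∈? U) ×-dec ¬? (v ∈? z))
      U∩z : card (U ∩ z) ≡ a₁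
      U∩z = count-⇔ vecs (_∈? U ∩ z) (λ v → (v ∈? U) ×-dec (v ∈? z))
        (λ v v∈ → app (∩-≼ˡ U z) v∈ , app (∩-≼ʳ U z) v∈) (λ v (v∈U , v∈z) → ∩-∈ U z v∈U v∈z)
      in-z : count vecs (λ v → all? v ×-dec (v ∈? z)) ≡ card z
      in-z = count-⇔ vecs (λ v → all? v ×-dec (v ∈? z)) (_∈? z) (λ _ → proj₂) (λ _ → tt ,_)
      out-z : count vecs (λ v → all? v ×-dec ¬? (v ∈? z)) ≡ a₂ + count vecs (outside? h)
      out-z = ≡.trans
        (count-⇔ vecs (λ v → all? v ×-dec ¬? (v ∈? z)) (λ v → ¬? (v ∈? z)) (λ _ → proj₂) (λ _ → tt ,_))
        (≡.trans (count-split vecs (λ v → ¬? (v ∈? z)) (_∈? U))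
          (≡.cong (_+ count vecs (outside? h))
            (count-⇔ vecs (λ v → ¬? (v ∈? z) ×-dec (v ∈? U)) (λ v → (v ∈? U) ×-dec ¬? (v ∈? z))
              (λ _ (s , t) → t , s) (λ _ (s , t) → t , s))))

    κ-cancel : ∀ e {s t} → q ^ e * p * s ≡ q ^ e * p * t → s ≡ t
    κ-cancel e = ℕ.*-cancelˡ-≡ _ _ (q ^ e * p) {{ℕ.m*n≢0 (q ^ e) p {{ℕ.m^n≢0 q e}}}}

    dim-h⊕x : ∀ h j → Meet h → δ ≡ α → dim α + j ≡ dim z → dim (h ⊕ x) ≡ dim h + j
    dim-h⊕x h j (_ , h∩x≡δ) δ≡α eq = ℕ.+-cancelˡ-≡ (dim α) _ _ (begin
      dim α + dim (h ⊕ x)        ≡⟨ ≡.cong (λ U → dim U + dim (h ⊕ x)) (≡.trans h∩x≡δ δ≡α) ⟨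
      dim (h ∩ x) + dim (h ⊕ x)  ≡⟨ dim-⊕-∩ h x ⟨
      dim x + dim h              ≡⟨ ≡.cong (_+ dim h) (≡.trans dim-x≡dim-z (≡.sym eq)) ⟩
      dim α + j + dim h          ≡⟨ ℕ.+-assoc (dim α) j (dim h) ⟩
      dim α + (j + dim h)        ≡⟨ ≡.cong (dim α +_) (ℕ.+-comm j (dim h)) ⟩
      dim α + (dim h + j)        ∎)
      where open ≡.≡-Reasoning

    -- Since `γ = α = δ` lies in `h`, the modular law gives `(h ⊕ x) ∩ z = h`. Inclusion-exclusion
    -- then yields `[n + 1] - 1 - [j]`, which is `q [n] - [j]`.
    nearThrough-same : ∀ j n → γ ≡ α → dim α + j ≡ dim z → dim z + n ≡ N → ∀ h → Meet h →
      count subspaces (nearThrough? h) + g j ≡ q * g n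
    nearThrough-same j n γ≡α eq-j eq-n h meet@((h≼z , dim-h) , h∩x≡δ) =
      -- With `q = 1 + p`, the summand `T + T + T * p` is `q ^ dim h + q ^ dim z`, common to both
      -- sides of the inclusion-exclusion.
      κ-cancel (dim h) (ℕ.+-cancelˡ-≡ (T + T + T * p) _ _ (begin
        T + T + T * p + T * p * (M + g j)
          ≡⟨ shuffle₁ T p M (g j) ⟩
        (1 + p) * T + T * (1 + p * g j) + T * p * M
          ≡⟨ ≡.cong₂ _+_ (≡.cong₂ _+_ q^dim-z q^dim-h⊕x) (≡.sym (count-nearThrough-α δ≡α h meet)) ⟨
        q ^ dim z + q ^ dim (h ⊕ x) + count vecs (outside? h)
          ≡⟨ count-outside h ⟨
        q ^ dim ((h ⊕ x) ∩ z) + q ^ N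
          ≡⟨ ≡.cong₂ _+_ (≡.cong (λ U → q ^ dim U) h⊕x∩z≡h) q^N ⟩
        T + T * (1 + p * (1 + q * g n))
          ≡⟨ shuffle₂ T p (q * g n) ⟩
        T + T + T * p + T * p * (q * g n) ∎))
      where
      open ≡.≡-Reasoning
      T M : ℕ
      T = q ^ dim h
      M = count subspaces (nearThrough? h)
      shuffle₁ : ∀ T p M J → T + T + T * p + T * p * (M + J)
                             ≡ (1 + p) * T + T * (1 + p * J) + T * p * M
      shuffle₁ = solve 4 (λ T p M J → T :+ T :+ T :* p :+ T :* p :* (M :+ J)
        := (con 1 :+ p) :* T :+ T :* (con 1 :+ p :* J) :+ T :* p :* M) refl
      shuffle₂ : ∀ T p G → T + T * (1 + p * (1 + G)) ≡ T + T + T * p + T * p * G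
      shuffle₂ = solve 3 (λ T p G → T :+ T :* (con 1 :+ p :* (con 1 :+ G))
        := T :+ T :+ T :* p :+ T :* p :* G) refl
      δ≡α : δ ≡ α
      δ≡α = ≼-antisym δ≼α (∩-greatest ≼-refl (≼-reflexive (≡.sym γ≡α)))
      q^dim-z : q ^ dim z ≡ (1 + p) * T
      q^dim-z = ≡.trans (≡.cong (q ^_) (≡.sym dim-h)) (≡.cong (_* T) q≡1+p)
      q^dim-h⊕x : q ^ dim (h ⊕ x) ≡ T * (1 + p * g j)
      q^dim-h⊕x = ≡.trans (≡.cong (q ^_) (dim-h⊕x h j meet δ≡α eq-j))
        (≡.trans (ℕ.^-distribˡ-+-* q (dim h) j) (≡.cong (T *_) (^≡1+gauss q j)))
      q^N : q ^ N ≡ T * (1 + p * g (suc n))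
      q^N = ≡.trans (≡.cong (q ^_) (≡.trans (≡.sym eq-n)
          (≡.trans (≡.cong (_+ n) (≡.sym dim-h)) (≡.sym (ℕ.+-suc (dim h) n)))))
        (≡.trans (ℕ.^-distribˡ-+-* q (dim h) (suc n)) (≡.cong (T *_) (^≡1+gauss q (suc n))))
      h⊕x∩z≡h : (h ⊕ x) ∩ z ≡ h
      h⊕x∩z≡h = ≼-antisym
        (≼-trans (modular x h≼z) (⊕-least ≼-refl (≼-trans (∩-greatest (∩-≼ʳ x z) (∩-≼ˡ x z))
          (≼-trans (≼-reflexive (≡.trans γ≡α (≡.trans (≡.sym δ≡α) (≡.sym h∩x≡δ)))) (∩-≼ˡ h x)))))
        (∩-greatest (⊕-≼ˡ h x) h≼z)

    -- Here `h ∩ γ = δ` while `γ` is one dimension larger, so `h ⊕ γ = z` and `z` lies inside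
    -- `h ⊕ x`. Only `h ⊕ x` has to be avoided, and `r` is its codimension in the whole space.
    nearThrough-below : ∀ j r → δ ≡ α → dim γ ≡ suc (dim δ) → dim α + j ≡ dim z →
      ∀ h → Meet h → dim h + j + r ≡ N → count subspaces (nearThrough? h) ≡ q ^ j * g r
    nearThrough-below j r δ≡α dim-γ eq-j h meet@((h≼z , dim-h) , h∩x≡δ) eq-r =
      κ-cancel (dim h) (ℕ.+-cancelˡ-≡ (q ^ dim z + S) _ _ (begin
        q ^ dim z + S + T * p * M
          ≡⟨ ≡.cong₂ (λ s t → q ^ dim z + s + t) (≡.cong (q ^_) (dim-h⊕x h j meet δ≡α eq-j))
               (≡.sym (count-nearThrough-α δ≡α h meet)) ⟨
        q ^ dim z + q ^ dim (h ⊕ x) + count vecs (outside? h)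
          ≡⟨ count-outside h ⟨
        q ^ dim ((h ⊕ x) ∩ z) + q ^ N
          ≡⟨ ≡.cong₂ _+_ (≡.cong (λ U → q ^ dim U) h⊕x∩z≡z) q^N ⟩
        q ^ dim z + S * (1 + p * g r)
          ≡⟨ ≡.cong (λ t → q ^ dim z + t) (≡.trans (ℕ.*-suc S _)
               (≡.cong (S +_) (≡.cong (_* (p * g r)) (ℕ.^-distribˡ-+-* q (dim h) j)))) ⟩
        q ^ dim z + (S + T * q ^ j * (p * g r))
          ≡⟨ shuffle (q ^ dim z) S T (q ^ j) p (g r) ⟩
        q ^ dim z + S + T * p * (q ^ j * g r) ∎))
      where
      open ≡.≡-Reasoning
      T S M : ℕ
      T = q ^ dim h
      S = q ^ (dim h + j)
      M = count subspaces (nearThrough? h)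
      shuffle : ∀ Z S T Q p G → Z + (S + T * Q * (p * G)) ≡ Z + S + T * p * (Q * G)
      shuffle = solve 6 (λ Z S T Q p G → Z :+ (S :+ T :* Q :* (p :* G)) := Z :+ S :+ T :* p :* (Q :* G)) refl
      q^N : q ^ N ≡ S * (1 + p * g r)
      q^N = ≡.trans (≡.cong (q ^_) (≡.sym eq-r))
        (≡.trans (ℕ.^-distribˡ-+-* q (dim h + j) r) (≡.cong (S *_) (^≡1+gauss q r)))
      h∩γ≡δ : h ∩ γ ≡ δ
      h∩γ≡δ = ≡.trans (≼-antisym (∩-greatest (∩-≼ˡ h γ) (≼-trans (∩-≼ʳ h γ) γ≼x))
        (∩-greatest (∩-≼ˡ h x) (∩-greatest (≼-trans (∩-≼ˡ h x) h≼z) (∩-≼ʳ h x)))) h∩x≡δ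
      dim-h⊕γ : dim (h ⊕ γ) ≡ dim z
      dim-h⊕γ = ℕ.+-cancelˡ-≡ (dim δ) _ _ (begin
        dim δ + dim (h ⊕ γ)        ≡⟨ ≡.cong (λ U → dim U + dim (h ⊕ γ)) h∩γ≡δ ⟨
        dim (h ∩ γ) + dim (h ⊕ γ)  ≡⟨ dim-⊕-∩ h γ ⟨
        dim γ + dim h              ≡⟨ ≡.cong (_+ dim h) dim-γ ⟩
        suc (dim δ) + dim h        ≡⟨ ℕ.+-suc (dim δ) (dim h) ⟨
        dim δ + suc (dim h)        ≡⟨ ≡.cong (dim δ +_) dim-h ⟩
        dim δ + dim z              ∎)
      h⊕γ≡z : h ⊕ γ ≡ z
      h⊕γ≡z = ≼∧dim≥⇒≡ (⊕-least h≼z γ≼z) (ℕ.≤-reflexive (≡.sym dim-h⊕γ))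
      h⊕x∩z≡z : (h ⊕ x) ∩ z ≡ z
      h⊕x∩z≡z = ≼-antisym (∩-≼ʳ (h ⊕ x) z) (∩-greatest
        (≼-trans (≼-reflexive (≡.sym h⊕γ≡z)) (⊕-least (⊕-≼ˡ h x) (≼-trans γ≼x (⊕-≼ʳ h x)))) ≼-refl)

-- Sums of four mutually exclusive indicators

module _ {p₁ p₂ p₃ p₄} {P₁ : Set p₁} {P₂ : Set p₂} {P₃ : Set p₃} {P₄ : Set p₄}
    (P₁? : Dec P₁) (P₂? : Dec P₂) (P₃? : Dec P₃) (P₄? : Dec P₄) (n₁ n₂ n₃ n₄ : ℕ) where

  -- The shape of the right-hand side at a vertex: each coefficient times the indicator of one
  -- position of `γ`.
  weighted : ℕ
  weighted = n₁ * 𝟙 P₁? + n₂ * 𝟙 P₂? + n₃ * 𝟙 P₃? + n₄ * 𝟙 P₄?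

  private
    weights : ∀ {a b c d} → 𝟙 P₁? ≡ a → 𝟙 P₂? ≡ b → 𝟙 P₃? ≡ c → 𝟙 P₄? ≡ d →
      weighted ≡ n₁ * a + n₂ * b + n₃ * c + n₄ * d
    weights refl refl refl refl = refl

  weighted-none : ¬ P₁ → ¬ P₂ → ¬ P₃ → ¬ P₄ → weighted ≡ 0
  weighted-none ¬1 ¬2 ¬3 ¬4 = ≡.trans (weights (𝟙-no P₁? ¬1) (𝟙-no P₂? ¬2) (𝟙-no P₃? ¬3) (𝟙-no P₄? ¬4))
    (solve 4 (λ a b c d → a :* con 0 :+ b :* con 0 :+ c :* con 0 :+ d :* con 0 := con 0) refl n₁ n₂ n₃ n₄)

  weighted-1 : P₁ → ¬ P₂ → ¬ P₃ → ¬ P₄ → weighted ≡ n₁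
  weighted-1 p ¬2 ¬3 ¬4 = ≡.trans (weights (𝟙-yes P₁? p) (𝟙-no P₂? ¬2) (𝟙-no P₃? ¬3) (𝟙-no P₄? ¬4))
    (solve 4 (λ a b c d → a :* con 1 :+ b :* con 0 :+ c :* con 0 :+ d :* con 0 := a) refl n₁ n₂ n₃ n₄)

  weighted-2 : ¬ P₁ → P₂ → ¬ P₃ → ¬ P₄ → weighted ≡ n₂
  weighted-2 ¬1 p ¬3 ¬4 = ≡.trans (weights (𝟙-no P₁? ¬1) (𝟙-yes P₂? p) (𝟙-no P₃? ¬3) (𝟙-no P₄? ¬4))
    (solve 4 (λ a b c d → a :* con 0 :+ b :* con 1 :+ c :* con 0 :+ d :* con 0 := b) refl n₁ n₂ n₃ n₄)

  weighted-3 : ¬ P₁ → ¬ P₂ → P₃ → ¬ P₄ → weighted ≡ n₃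
  weighted-3 ¬1 ¬2 p ¬4 = ≡.trans (weights (𝟙-no P₁? ¬1) (𝟙-no P₂? ¬2) (𝟙-yes P₃? p) (𝟙-no P₄? ¬4))
    (solve 4 (λ a b c d → a :* con 0 :+ b :* con 0 :+ c :* con 1 :+ d :* con 0 := c) refl n₁ n₂ n₃ n₄)

  weighted-4 : ¬ P₁ → ¬ P₂ → ¬ P₃ → P₄ → weighted ≡ n₄
  weighted-4 ¬1 ¬2 ¬3 p = ≡.trans (weights (𝟙-no P₁? ¬1) (𝟙-no P₂? ¬2) (𝟙-no P₃? ¬3) (𝟙-yes P₄? p))
    (solve 4 (λ a b c d → a :* con 0 :+ b :* con 0 :+ c :* con 0 :+ d :* con 1 := d) refl n₁ n₂ n₃ n₄)

  ≡weighted : ∀ {n} → (P₁ → n ≡ n₁) → (P₂ → n ≡ n₂) → (P₃ → n ≡ n₃) → (P₄ → n ≡ n₄) →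
    (¬ P₁ → ¬ P₂ → ¬ P₃ → ¬ P₄ → n ≡ 0) →
    (P₁ → ¬ P₂ × ¬ P₃ × ¬ P₄) → (P₂ → ¬ P₃ × ¬ P₄) → (P₃ → ¬ P₄) → n ≡ weighted
  ≡weighted {n} f₁ f₂ f₃ f₄ f₀ e₁ e₂ e₃ = go P₁? P₂? P₃? P₄?
    where
    go : Dec P₁ → Dec P₂ → Dec P₃ → Dec P₄ → n ≡ weighted
    go (yes p) _ _ _ = let ¬2 , ¬3 , ¬4 = e₁ p in ≡.trans (f₁ p) (≡.sym (weighted-1 p ¬2 ¬3 ¬4))
    go (no ¬1) (yes p) _ _ = let ¬3 , ¬4 = e₂ p in ≡.trans (f₂ p) (≡.sym (weighted-2 ¬1 p ¬3 ¬4))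
    go (no ¬1) (no ¬2) (yes p) _ = ≡.trans (f₃ p) (≡.sym (weighted-3 ¬1 ¬2 p (e₃ p)))
    go (no ¬1) (no ¬2) (no ¬3) (yes p) = ≡.trans (f₄ p) (≡.sym (weighted-4 ¬1 ¬2 ¬3 p))
    go (no ¬1) (no ¬2) (no ¬3) (no ¬4) = ≡.trans (f₀ ¬1 ¬2 ¬3 ¬4) (≡.sym (weighted-none ¬1 ¬2 ¬3 ¬4))

≤suc⇒≡⊎≡suc : ∀ {m n} → m ≤ n → n ≤ suc m → n ≡ m ⊎ n ≡ suc m
≤suc⇒≡⊎≡suc m≤n n≤1+m with ℕ.m≤n⇒m<n∨m≡n n≤1+m
... | inj₁ n<1+m = inj₁ (ℕ.≤-antisym (ℕ.≤-pred n<1+m) m≤n)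
... | inj₂ n≡1+m = inj₂ n≡1+m

-- The four positions of `γ` relative to `α`

module CaseAnalysis {q a ℓ₁ ℓ₂} (F : FiniteField q a ℓ₁ ℓ₂) {N m ℓm} (𝒱 : VectorSpace F N m ℓm) where
  open Subspaces F 𝒱
  open SubspaceProperties F 𝒱
  open Neighbours F 𝒱 hiding (γ; δ)

  covers⇒ : ∀ {U W} → W covers U → U ≼ W × dim W ≡ suc (dim U)
  covers⇒ {U} {W} (U⊆W , d , dim-U , dim-W) =
    ⊆⇒≼ {U} {W} U⊆W , ≡.trans (hasDim⇒dim W dim-W) (≡.cong suc (≡.sym (hasDim⇒dim U dim-U)))

  ⇒covers : ∀ {U W} → U ≼ W → dim W ≡ suc (dim U) → W covers U
  ⇒covers {U} {W} U≼W eq = ≼⇒⊆ {U} {W} U≼W , dim U , hasDim-dim U , dim⇒hasDim W eq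

  -- The dimension formula for `h` and `U`, whose sum stays inside `W`.
  dim-≤-hyperplane : ∀ {W h} U → U ≼ W → h ≼ W → suc (dim h) ≡ dim W → dim U ≤ suc (dim (h ∩ U))
  dim-≤-hyperplane {W} {h} U U≼W h≼W eq = ℕ.+-cancelʳ-≤ (dim h) _ _ (begin
    dim U + dim h                ≡⟨ dim-⊕-∩ h U ⟩
    dim (h ∩ U) + dim (h ⊕ U)    ≤⟨ ℕ.+-monoʳ-≤ (dim (h ∩ U)) (dim-mono (⊕-least h≼W U≼W)) ⟩
    dim (h ∩ U) + dim W          ≡⟨ ≡.cong (dim (h ∩ U) +_) eq ⟨
    dim (h ∩ U) + suc (dim h)    ≡⟨ ℕ.+-suc (dim (h ∩ U)) (dim h) ⟩
    suc (dim (h ∩ U)) + dim h    ∎)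
    where open ℕ.≤-Reasoning

  above? : ∀ x α β → Dec (β ⊆ x × β covers α)
  above? x α β = β ⊆? x ×-dec β covers? α

  beside? : ∀ x α β → Dec (β ⊆ x × α covers (α ∩ β) × β covers (α ∩ β))
  beside? x α β = β ⊆? x ×-dec α covers? (α ∩ β) ×-dec β covers? (α ∩ β)

  module _ {x z α : Subspace} (dim-x≡dim-z : dim x ≡ dim z) (α≼x : α ≼ x)
      (j t : ℕ) (eq-j : dim α + j ≡ dim z) (eq-t : dim z + (dim z + t) ≡ N) where
    private
      γ δ : Subspace
      γ = z ∩ x
      δ = α ∩ γ

      Near? : ∀ y → Dec (Near {x} {z} {α} dim-x≡dim-z α≼x y)
      Near? = near? {x} {z} {α} dim-x≡dim-z α≼x

      g : ℕ → ℕ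
      g = gauss q

      γ≼x′ : γ ≼ x
      γ≼x′ = ∩-≼ʳ z x

      -- The four coefficients as natural numbers, with `D = dim z`, `j = D - i` and `t = N - 2D`.
      -- Each is the number of hyperplanes `h` times the number of `y` through one of them. The
      -- exponent `j + pred j` is `2D - 2i - 1` as soon as `j` is positive.
      n₁ n₂ n₃ n₄ : ℕ
      n₁ = g j * (q * g (dim z + t) ∸ g j)
      n₂ = q ^ (j + pred j) * g (suc (t + dim α))
      n₃ = q ^ j
      n₄ = g (suc j)

    count-near-equal : γ ≡ α → count subspaces Near? ≡ n₁
    count-near-equal γ≡α = begin
      count subspaces Near?
        ≡⟨ count-near dim-x≡dim-z α≼x _ (λ h meet → ≡.trans (≡.sym (ℕ.m+n∸n≡m _ (g j))) (≡.cong (_∸ g j)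
             (nearThrough-same dim-x≡dim-z α≼x j (dim z + t) γ≡α eq-j eq-t h meet))) ⟩
      (q * g (dim z + t) ∸ g j) * count subspaces (meet? dim-x≡dim-z α≼x)
        ≡⟨ ≡.cong ((q * g (dim z + t) ∸ g j) *_) (count-meet-γ dim-x≡dim-z α≼x j δ≡γ
             (≡.trans (≡.cong (λ U → dim U + j) γ≡α) eq-j)) ⟩
      (q * g (dim z + t) ∸ g j) * g j
        ≡⟨ ℕ.*-comm _ (g j) ⟩
      g j * (q * g (dim z + t) ∸ g j) ∎
      where
      open ≡.≡-Reasoning
      δ≡γ : δ ≡ γ
      δ≡γ = ≼-antisym (∩-≼ʳ α γ) (∩-greatest (≼-reflexive γ≡α) ≼-refl)

    count-near-above : α ≼ γ → dim γ ≡ suc (dim α) → count subspaces Near? ≡ n₂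
    count-near-above α≼γ dim-γ = begin
      count subspaces Near?
        ≡⟨ count-near dim-x≡dim-z α≼x _ (λ h meet → nearThrough-below dim-x≡dim-z α≼x j (suc (t + dim α))
             δ≡α dim-γ′ eq-j h meet (eq-r h meet)) ⟩
      q ^ j * g (suc (t + dim α)) * count subspaces (meet? dim-x≡dim-z α≼x)
        ≡⟨ ≡.cong (q ^ j * g (suc (t + dim α)) *_) (count-meet-δ dim-x≡dim-z α≼x (pred j) dim-γ′ eq-d) ⟩
      q ^ j * g (suc (t + dim α)) * q ^ pred j
        ≡⟨ ℕ.*-assoc (q ^ j) _ _ ⟩
      q ^ j * (g (suc (t + dim α)) * q ^ pred j)
        ≡⟨ ≡.cong (q ^ j *_) (ℕ.*-comm (g (suc (t + dim α))) (q ^ pred j)) ⟩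
      q ^ j * (q ^ pred j * g (suc (t + dim α)))
        ≡⟨ ℕ.*-assoc (q ^ j) _ _ ⟨
      q ^ j * q ^ pred j * g (suc (t + dim α))
        ≡⟨ ≡.cong (_* g (suc (t + dim α))) (ℕ.^-distribˡ-+-* q j (pred j)) ⟨
      q ^ (j + pred j) * g (suc (t + dim α)) ∎
      where
      open ≡.≡-Reasoning
      δ≡α : δ ≡ α
      δ≡α = ≼-antisym (∩-≼ˡ α γ) (∩-greatest ≼-refl α≼γ)
      dim-γ′ : dim γ ≡ suc (dim δ)
      dim-γ′ = ≡.trans dim-γ (≡.cong (suc ∘ dim) (≡.sym δ≡α))
      eq-d : dim γ + pred j ≡ dim z
      eq-d = lemma j eq-j
        where
        lemma : ∀ j → dim α + j ≡ dim z → dim γ + pred j ≡ dim z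
        -- If `j = 0`, then `γ` would have dimension `dim z + 1` inside `z`.
        lemma zero    eq = contradiction (dim-mono (∩-≼ˡ z x)) (ℕ.<⇒≱
          (ℕ.≤-reflexive (≡.trans (≡.cong suc (≡.trans (≡.sym eq) (ℕ.+-identityʳ _))) (≡.sym dim-γ))))
        lemma (suc j) eq = ≡.trans (≡.cong (_+ j) dim-γ) (≡.trans (≡.sym (ℕ.+-suc (dim α) j)) eq)
      shuffle : ∀ h j t i → h + j + suc (t + i) ≡ suc h + ((i + j) + t)
      shuffle = solve 4 (λ h j t i → h :+ j :+ (con 1 :+ (t :+ i)) := con 1 :+ h :+ ((i :+ j) :+ t)) refl
      eq-r : ∀ h → Meet dim-x≡dim-z α≼x h → dim h + j + suc (t + dim α) ≡ N
      eq-r h ((_ , dim-h) , _) = ≡.trans (shuffle (dim h) j t (dim α))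
        (≡.trans (≡.cong₂ (λ c d → c + (d + t)) dim-h eq-j) eq-t)

    count-near-beside : dim α ≡ suc (dim δ) → dim γ ≡ suc (dim δ) → count subspaces Near? ≡ n₃
    count-near-beside dim-α dim-γ = ≡.trans
      (count-near dim-x≡dim-z α≼x 1 (count-nearThrough-δ dim-x≡dim-z α≼x dim-α))
      (≡.trans (ℕ.*-identityˡ _) (count-meet-δ dim-x≡dim-z α≼x j dim-γ
        (≡.trans (≡.cong (_+ j) (≡.trans dim-γ (≡.sym dim-α))) eq-j)))

    count-near-below : γ ≼ α → dim α ≡ suc (dim γ) → count subspaces Near? ≡ n₄
    count-near-below γ≼α dim-α = ≡.trans
      (count-near dim-x≡dim-z α≼x 1 (count-nearThrough-δ dim-x≡dim-z α≼x
        (≡.trans dim-α (≡.cong (suc ∘ dim) (≡.sym δ≡γ)))))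
      (≡.trans (ℕ.*-identityˡ _) (count-meet-γ dim-x≡dim-z α≼x (suc j) δ≡γ
        (≡.trans (ℕ.+-suc (dim γ) j) (≡.trans (≡.cong (_+ j) (≡.sym dim-α)) eq-j))))
      where
      δ≡γ : δ ≡ γ
      δ≡γ = ≼-antisym (∩-≼ʳ α γ) (∩-greatest γ≼α ≼-refl)

    near⇒dims : ∀ y → Near {x} {z} {α} dim-x≡dim-z α≼x y → dim α ≤ suc (dim δ) × dim γ ≤ suc (dim δ)
    near⇒dims y near@(dim-y , dim-h , y∩x≡α) =
        ≡.subst (λ U → dim α ≤ suc (dim U)) h∩α≡δ
          (dim-≤-hyperplane α α≼y (∩-≼ˡ y z) (≡.trans dim-h (≡.sym dim-y)))
      , ≡.subst (λ U → dim γ ≤ suc (dim U)) h∩γ≡δ (dim-≤-hyperplane γ (∩-≼ˡ z x) (∩-≼ʳ y z) dim-h)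
      where
      h : Subspace
      h = y ∩ z
      h∩x≡δ : h ∩ x ≡ δ
      h∩x≡δ = proj₂ (near⇒meet {x} {z} {α} dim-x≡dim-z α≼x y near)
      δ≼h : δ ≼ h
      δ≼h = ≼-trans (≼-reflexive (≡.sym h∩x≡δ)) (∩-≼ˡ h x)
      α≼y : α ≼ y
      α≼y = ≼-trans (≼-reflexive (≡.sym y∩x≡α)) (∩-≼ˡ y x)
      h∩α≡δ : h ∩ α ≡ δ
      h∩α≡δ = ≼-antisym (≼-trans (∩-greatest (∩-≼ˡ h α) (≼-trans (∩-≼ʳ h α) α≼x)) (≼-reflexive h∩x≡δ))
                        (∩-greatest δ≼h (∩-≼ˡ α γ))
      h∩γ≡δ : h ∩ γ ≡ δ
      h∩γ≡δ = ≼-antisym (≼-trans (∩-greatest (∩-≼ˡ h γ) (≼-trans (∩-≼ʳ h γ) γ≼x′)) (≼-reflexive h∩x≡δ))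
                        (∩-greatest δ≼h (∩-≼ʳ α γ))

    -- The codimensions of `δ` in `α` and in `γ` are each 0 or 1, and the four combinations are the
    -- four positions. The negative form suits its use: once all four decisions have failed, no near
    -- `y` is left.
    near⇒position : ∀ y → Near {x} {z} {α} dim-x≡dim-z α≼x y →
      γ ≢ α → ¬ γ covers α → ¬ (α covers δ × γ covers δ) → ¬ ¬ α covers γ
    near⇒position y near γ≢α ¬above ¬beside ¬below =
      position (≤suc⇒≡⊎≡suc (dim-mono δ≼α′) (proj₁ dims)) (≤suc⇒≡⊎≡suc (dim-mono δ≼γ′) (proj₂ dims))
      where
      δ≼α′ : δ ≼ α
      δ≼α′ = ∩-≼ˡ α γ
      δ≼γ′ : δ ≼ γ
      δ≼γ′ = ∩-≼ʳ α γ
      dims : dim α ≤ suc (dim δ) × dim γ ≤ suc (dim δ)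
      dims = near⇒dims y near
      equal : ∀ {U} → δ ≼ U → dim U ≡ dim δ → δ ≡ U
      equal δ≼U eq = ≼∧dim≥⇒≡ δ≼U (ℕ.≤-reflexive eq)
      position : dim α ≡ dim δ ⊎ dim α ≡ suc (dim δ) → ¬ (dim γ ≡ dim δ ⊎ dim γ ≡ suc (dim δ))
      position (inj₁ a) (inj₁ c) = γ≢α (≡.trans (≡.sym (equal δ≼γ′ c)) (equal δ≼α′ a))
      position (inj₁ a) (inj₂ c) = ¬above (≡.subst (γ covers_) (equal δ≼α′ a) (⇒covers δ≼γ′ c))
      position (inj₂ a) (inj₁ c) = ¬below (≡.subst (α covers_) (equal δ≼γ′ c) (⇒covers δ≼α′ a))
      position (inj₂ a) (inj₂ c) = ¬beside (⇒covers δ≼α′ a , ⇒covers δ≼γ′ c)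

    count-near-cases : count subspaces Near? ≡
      weighted (γ ≟ α) (above? x α γ) (beside? x α γ) (α covers? γ) n₁ n₂ n₃ n₄
    count-near-cases = ≡weighted (γ ≟ α) (above? x α γ) (beside? x α γ) (α covers? γ) n₁ n₂ n₃ n₄
      count-near-equal
      (λ (_ , c) → count-near-above (proj₁ (covers⇒ c)) (above⇒dim c))
      (λ (_ , b) → count-near-beside (proj₁ (beside⇒dim b)) (proj₂ (beside⇒dim b)))
      (λ c → count-near-below (proj₁ (covers⇒ c)) (below⇒dim c))
      (λ ¬e ¬c ¬b ¬c′ → count-none subspaces Near? (λ y near → near⇒position y near ¬e
          (λ c → ¬c (≼⇒⊆ {γ} {x} γ≼x′ , c)) (λ b → ¬b (≼⇒⊆ {γ} {x} γ≼x′ , b)) ¬c′))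
      -- The difference `dim γ - dim α` is 0, 1, 0, -1 in the four positions. The two with
      -- difference 0 are separated by `δ`, which equals `α` only in the first.
      (λ e → (λ (_ , c) → ℕ.1+n≢n (≡.trans (≡.sym (above⇒dim c)) (equal⇒dim e)))
           , (λ (_ , c) → ¬beside e c)
           , (λ c → ℕ.1+n≢n (≡.trans (≡.sym (below⇒dim c)) (≡.sym (equal⇒dim e)))))
      (λ (_ , c) → (λ (_ , b) → ℕ.1+n≢n (≡.trans (≡.sym (above⇒dim c)) (beside⇒dim-≡ b)))
                 , (λ c′ → ℕ.<-asym (ℕ.≤-reflexive (≡.sym (above⇒dim c)))
                                    (ℕ.≤-reflexive (≡.sym (below⇒dim c′)))))
      (λ (_ , b) c → ℕ.1+n≢n (≡.trans (≡.sym (below⇒dim c)) (≡.sym (beside⇒dim-≡ b))))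
      where
      equal⇒dim : γ ≡ α → dim γ ≡ dim α
      equal⇒dim = ≡.cong dim
      above⇒dim : γ covers α → dim γ ≡ suc (dim α)
      above⇒dim c = proj₂ (covers⇒ c)
      below⇒dim : α covers γ → dim α ≡ suc (dim γ)
      below⇒dim c = proj₂ (covers⇒ c)
      beside⇒dim : α covers δ × γ covers δ → dim α ≡ suc (dim δ) × dim γ ≡ suc (dim δ)
      beside⇒dim (c , c′) = proj₂ (covers⇒ c) , proj₂ (covers⇒ c′)
      beside⇒dim-≡ : α covers δ × γ covers δ → dim γ ≡ dim α
      beside⇒dim-≡ b = ≡.trans (proj₂ (beside⇒dim b)) (≡.sym (proj₁ (beside⇒dim b)))
      ¬beside : γ ≡ α → ¬ (α covers δ × γ covers δ)
      ¬beside γ≡α b = ℕ.<⇒≱ (ℕ.≤-reflexive (≡.sym (proj₁ (beside⇒dim b))))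
        (dim-mono (∩-greatest ≼-refl (≼-reflexive (≡.sym γ≡α))))

open import Data.Integer.Base using (+_)

pos-∸ : ∀ m n {k} → m ≡ n + k → + m ℤ.- + n ≡ + k
pos-∸ m n {k} refl = ≡.trans (ℤ.m-n≡m⊖n (n + k) n)
  (≡.trans (ℤ.⊖-≥ (ℕ.m≤m+n n k)) (≡.cong +_ (ℕ.m+n∸m≡n n k)))

-- Evaluation over a field of characteristic zero

module Scalars {k ℓ₃ ℓ₄} (K : CharZeroField k ℓ₃ ℓ₄) where
  open CharZeroField K hiding (refl)
    renaming (_≈_ to _≈ᴷ_; _+_ to _+ᴷ_; _-_ to _-ᴷ_; _*_ to _*ᴷ_; _^_ to _^ᴷ_)
  open SemiringMult semiring using (×-homo-+; ×1-homo-*; ×-homo-1)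
  open SetoidReasoning setoid

  ι : ℕ → Carrier
  ι n = n ×ⁿ 1#

  ι-+ : ∀ m n → ι (m + n) ≈ᴷ ι m +ᴷ ι n
  ι-+ = ×-homo-+ 1#

  ι-+-+-+ : ∀ a b c d → ι (a + b + c + d) ≈ᴷ ι a +ᴷ ι b +ᴷ ι c +ᴷ ι d
  ι-+-+-+ a b c d = trans (ι-+ (a + b + c) d) (+-congʳ (trans (ι-+ (a + b) c) (+-congʳ (ι-+ a b))))

  ι-* : ∀ m n → ι (m * n) ≈ᴷ ι m *ᴷ ι n
  ι-* = ×1-homo-*

  ι-1 : ι 1 ≈ᴷ 1#
  ι-1 = ×-homo-1 1#

  ι-^ : ∀ m n → ι (m ^ n) ≈ᴷ ι m ^ᴷ n
  ι-^ m zero    = ι-1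
  ι-^ m (suc n) = trans (ι-* m (m ^ n)) (*-congˡ (ι-^ m n))

  ι-cong : ∀ {m n} → m ≡ n → ι m ≈ᴷ ι n
  ι-cong eq = reflexive (≡.cong ι eq)

  ι-∸ : ∀ {m n} → n ≤ m → ι (m ∸ n) ≈ᴷ ι m -ᴷ ι n
  ι-∸ {m} {n} n≤m = begin
    ι (m ∸ n)                  ≈⟨ +-identityʳ _ ⟨
    ι (m ∸ n) +ᴷ 0#             ≈⟨ +-congˡ (-‿inverseʳ (ι n)) ⟨
    ι (m ∸ n) +ᴷ (ι n -ᴷ ι n)    ≈⟨ +-assoc _ _ _ ⟨
    ι (m ∸ n) +ᴷ ι n -ᴷ ι n      ≈⟨ +-congʳ (ι-+ (m ∸ n) n) ⟨
    ι (m ∸ n + n) -ᴷ ι n      ≈⟨ +-congʳ (ι-cong (ℕ.m∸n+n≡m n≤m)) ⟩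
    ι m -ᴷ ι n                  ∎

  ι-𝟙 : ∀ {p} {P : Set p} (P? : Dec P) → (if does P? then 1# else 0#) ≈ᴷ ι (𝟙 P?)
  ι-𝟙 d@(yes p) = trans (sym ι-1) (ι-cong (≡.sym (𝟙-yes d p)))
  ι-𝟙 d@(no ¬p) = ι-cong (≡.sym (𝟙-no d ¬p))

  -- The coefficient `c` has to be a natural number only where its indicator is 1. This admits the
  -- second coefficient, whose exponent may be negative.
  *-ι𝟙 : ∀ {p} {P : Set p} (P? : Dec P) {c n} → (P → c ≈ᴷ ι n) → c *ᴷ ι (𝟙 P?) ≈ᴷ ι (n * 𝟙 P?)
  *-ι𝟙 d@(yes p) {c} {n} c≈ = trans (*-congʳ (c≈ p)) (sym (ι-* n (𝟙 d)))
  *-ι𝟙 d@(no ¬p) {c} {n} c≈ = begin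
    c *ᴷ ι (𝟙 d)   ≈⟨ *-congˡ (ι-cong (𝟙-no d ¬p)) ⟩
    c *ᴷ 0#        ≈⟨ zeroʳ c ⟩
    0#            ≈⟨ ι-cong (≡.trans (≡.sym (ℕ.*-zeroʳ n)) (≡.cong (n *_) (≡.sym (𝟙-no d ¬p)))) ⟩
    ι (n * 𝟙 d) ∎

  module _ {q} (1<q : 1 < q) where
    open QNumbers K 1<q

    private instance
      q-nonZero : NonZero q
      q-nonZero = ℕ.>-nonZero (ℕ.<-trans (s≤s z≤n) 1<q)

    q^-pos : ∀ {ℓ n} → ℓ ≡ + n → q^ ℓ ≈ᴷ ι (q ^ n)
    q^-pos {n = n} refl = sym (ι-^ q n)

    -- The numerator is `(q - 1)` times the natural number `gauss q n`, so the reciprocal of `q - 1`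
    -- cancels.
    []-pos : ∀ {ℓ n} → ℓ ≡ + n → [ ℓ ] ≈ᴷ ι (gauss q n)
    []-pos {n = n} refl = begin
      (qᴷ ^ᴷ n -ᴷ 1#) *ᴷ r                ≈⟨ *-congʳ numerator ⟩
      (qᴷ -ᴷ 1#) *ᴷ ι (gauss q n) *ᴷ r    ≈⟨ *-congʳ (*-comm _ _) ⟩
      ι (gauss q n) *ᴷ (qᴷ -ᴷ 1#) *ᴷ r    ≈⟨ *-assoc _ _ _ ⟩
      ι (gauss q n) *ᴷ ((qᴷ -ᴷ 1#) *ᴷ r)  ≈⟨ *-congˡ (proj₂ (proj₂ (#⇒invertible qᴷ#1))) ⟩
      ι (gauss q n) *ᴷ 1#               ≈⟨ *-identityʳ _ ⟩
      ι (gauss q n)                    ∎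
      where
      r : Carrier
      r = recip qᴷ#1
      ι-pred : ∀ {m} → 1 ≤ m → ι m -ᴷ 1# ≈ᴷ ι (pred m)
      ι-pred {suc m} _ = trans (+-congʳ (+-comm 1# (ι m))) (trans (+-assoc _ _ _)
        (trans (+-congˡ (-‿inverseʳ 1#)) (+-identityʳ _)))
      numerator : qᴷ ^ᴷ n -ᴷ 1# ≈ᴷ (qᴷ -ᴷ 1#) *ᴷ ι (gauss q n)
      numerator = begin
        qᴷ ^ᴷ n -ᴷ 1#                        ≈⟨ +-congʳ (ι-^ q n) ⟨
        ι (q ^ n) -ᴷ 1#                   ≈⟨ ι-pred (ℕ.m^n>0 q n) ⟩
        ι (pred (q ^ n))                 ≈⟨ ι-cong (≡.cong pred (^≡1+gauss q n)) ⟩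
        ι (pred q * gauss q n)           ≈⟨ ι-* (pred q) (gauss q n) ⟩
        ι (pred q) *ᴷ ι (gauss q n)         ≈⟨ *-congʳ (ι-pred (ℕ.<⇒≤ 1<q)) ⟨
        (qᴷ -ᴷ 1#) *ᴷ ι (gauss q n)          ∎

-- Both sides of the identity at a vertex

module Evaluation {q a ℓ₁ ℓ₂} (F : FiniteField q a ℓ₁ ℓ₂) {N m ℓm} (𝒱 : VectorSpace F N m ℓm)
    (D : ℕ) {k ℓ₃ ℓ₄} (K : CharZeroField k ℓ₃ ℓ₄) where
  open Grassmann F 𝒱 D K
  open SubspaceProperties F 𝒱
  open Neighbours F 𝒱 using (near?)
  open CaseAnalysis F 𝒱
  open Scalars K
  open CharZeroField K using (+-cong; *-cong; *-congˡ; -‿cong; trans; sym; reflexive)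

  ∑-evaluate : ∀ {b p} {B : Set b} {P : Pred B p} (xs : List B) (P? : Decidable P) (f : B → V)
    (n : B → ℕ) z →
    (∀ b → f b z ≈ᴷ ι (n b)) → ∑ xs P? f z ≈ᴷ ι (total xs (λ b → 𝟙 (P? b) * n b))
  ∑-evaluate []       P? f n z f≈ = reflexive refl
  ∑-evaluate (x ∷ xs) P? f n z f≈ with P? x
  ... | d@(yes p) = trans (+-cong (f≈ x) (∑-evaluate xs P? f n z f≈)) (trans (sym (ι-+ (n x) rest))
          (ι-cong (≡.cong (_+ rest) (≡.trans (≡.sym (ℕ.*-identityˡ (n x)))
                                             (≡.cong (_* n x) (≡.sym (𝟙-yes d p)))))))
    where
    rest : ℕ
    rest = total xs (λ b → 𝟙 (P? b) * n b)
  ... | d@(no ¬p) = trans (∑-evaluate xs P? f n z f≈)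
          (ι-cong (≡.cong (λ k → k * n x + total xs (λ b → 𝟙 (P? b) * n b)) (≡.sym (𝟙-no d ¬p))))

  total-vertices : ∀ (f : Subspace → ℕ) →
    total vertices (f ∘ space) ≡ total subspaces (λ U → 𝟙 (hasDim? U D) * f U)
  total-vertices f = total-collect (λ U → hasDim? U D) vertex (f ∘ space) f (λ _ _ → refl) subspaces

  vertex-hasDim : ∀ z → HasDim (space z) D
  vertex-hasDim (vertex U h) = recompute (hasDim? U D) h

  vertex-dim : ∀ z → dim (space z) ≡ D
  vertex-dim z = hasDim⇒dim (space z) (vertex-hasDim z)

  -- In the sum over the vertices `y`, only `y = z` has a nonzero coordinate at `z`.
  𝒩-evaluate : ∀ β x z → (β ^𝒩[ x ]) z ≈ᴷ ι (𝟙 (space z ∩ space x ≟ β))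
  𝒩-evaluate β x z = trans
    (∑-evaluate vertices (λ y → space y ∩ space x ≟ β) hat (λ y → 𝟙 (space y ≟ space z)) z
      (λ y → ι-𝟙 (space y ≟ space z)))
    (ι-cong (begin
      total vertices (λ y → 𝟙 (space y ∩ space x ≟ β) * 𝟙 (space y ≟ space z))
        ≡⟨ total-vertices (λ U → 𝟙 (U ∩ space x ≟ β) * 𝟙 (U ≟ space z)) ⟩
      total subspaces (λ U → 𝟙 (hasDim? U D) * (𝟙 (U ∩ space x ≟ β) * 𝟙 (U ≟ space z)))
        ≡⟨ total-cong subspaces (λ U → ≡.trans (≡.sym (ℕ.*-assoc (𝟙 (hasDim? U D)) _ _))
                                           (ℕ.*-comm _ (𝟙 (U ≟ space z)))) ⟩
      total subspaces (λ U → 𝟙 (U ≟ space z) * (𝟙 (hasDim? U D) * 𝟙 (U ∩ space x ≟ β)))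
        ≡⟨ Subs.pick (space z) (λ U → 𝟙 (hasDim? U D) * 𝟙 (U ∩ space x ≟ β)) (λ { U refl → refl }) ⟩
      𝟙 (hasDim? (space z) D) * 𝟙 (space z ∩ space x ≟ β)
        ≡⟨ ≡.cong (_* 𝟙 (space z ∩ space x ≟ β)) (𝟙-yes (hasDim? (space z) D) (vertex-hasDim z)) ⟩
      1 * 𝟙 (space z ∩ space x ≟ β)
        ≡⟨ ℕ.*-identityˡ _ ⟩
      𝟙 (space z ∩ space x ≟ β) ∎))
    where open ≡.≡-Reasoning

  -- Only `β = z ∩ x` contributes at `z`, so a sum over `β` reduces to its index condition tested at
  -- `γ`.
  ∑𝒩-evaluate : ∀ {p} {P : Pred Subspace p} (P? : Decidable P) x z →
    ∑ subspaces P? (λ β → β ^𝒩[ x ]) z ≈ᴷ ι (𝟙 (P? (space z ∩ space x)))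
  ∑𝒩-evaluate P? x z = trans
    (∑-evaluate subspaces P? (λ β → β ^𝒩[ x ]) (λ β → 𝟙 (γ ≟ β)) z (λ β → 𝒩-evaluate β x z))
    (ι-cong (≡.trans
      (total-cong subspaces (λ β → ≡.trans (ℕ.*-comm (𝟙 (P? β)) (𝟙 (γ ≟ β)))
        (≡.cong (_* 𝟙 (P? β)) (𝟙-⇔ (γ ≟ β) (β ≟ γ) ≡.sym ≡.sym))))
      (Subs.pick γ (λ β → 𝟙 (P? β)) (λ { U refl → refl }))))
    where
    γ : Subspace
    γ = space z ∩ space x

  ∩-comm : ∀ U W → U ∩ W ≡ W ∩ U
  ∩-comm U W = ≼-antisym (∩-greatest (∩-≼ʳ U W) (∩-≼ˡ U W)) (∩-greatest (∩-≼ʳ W U) (∩-≼ˡ W U))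

  A𝒩-evaluate : 1 ≤ D → ∀ α x z (dim-x≡dim-z : dim (space x) ≡ dim (space z)) (α≼x : α ≼ space x) →
    (A *ⱽ α ^𝒩[ x ]) z ≈ᴷ ι (count subspaces (near? dim-x≡dim-z α≼x))
  A𝒩-evaluate 1≤D α x z dim-x≡dim-z α≼x = trans (sums vertices) (ι-cong (≡.trans
      (total-vertices (λ U → 𝟙 (hasDim? (space z ∩ U) (D ∸ 1)) * 𝟙 (U ∩ space x ≟ α)))
      (total-cong subspaces pointwise)))
    where
    sums : ∀ ys → foldr _+ᴷ_ 0# (map (λ y → A z y *ᴷ (α ^𝒩[ x ]) y) ys)
      ≈ᴷ ι (total ys (λ y → 𝟙 (adjacent? z y) * 𝟙 (space y ∩ space x ≟ α)))
    sums []       = reflexive refl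
    sums (y ∷ ys) = trans (+-cong (trans (*-cong (ι-𝟙 (adjacent? z y)) (𝒩-evaluate α x y))
      (sym (ι-* (𝟙 (adjacent? z y)) _))) (sums ys)) (sym (ι-+ (𝟙 (adjacent? z y) * 𝟙 (space y ∩ space x ≟ α)) _))
    -- Here `D ≥ 1` makes the truncated `D ∸ 1` in the adjacency relation a true predecessor.
    suc-D∸1 : suc (D ∸ 1) ≡ D
    suc-D∸1 = ℕ.m+[n∸m]≡n 1≤D
    pointwise : ∀ U → 𝟙 (hasDim? U D) * (𝟙 (hasDim? (space z ∩ U) (D ∸ 1)) * 𝟙 (U ∩ space x ≟ α))
                ≡ 𝟙 (near? dim-x≡dim-z α≼x U)
    pointwise U = ≡.trans
      (≡.trans (≡.cong (𝟙 (hasDim? U D) *_) (≡.sym (𝟙-× (hasDim? (space z ∩ U) (D ∸ 1)) (U ∩ space x ≟ α))))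
               (≡.sym (𝟙-× (hasDim? U D) (hasDim? (space z ∩ U) (D ∸ 1) ×-dec (U ∩ space x ≟ α)))))
      (𝟙-⇔ (hasDim? U D ×-dec hasDim? (space z ∩ U) (D ∸ 1) ×-dec (U ∩ space x ≟ α)) (near? dim-x≡dim-z α≼x U)
        (λ (dim-U , dim-z∩U , eq) → ≡.trans (hasDim⇒dim U dim-U) (≡.sym (vertex-dim z))
          , ≡.trans (≡.cong suc (≡.trans (≡.cong dim (∩-comm U (space z))) (hasDim⇒dim (space z ∩ U) dim-z∩U)))
                    (≡.trans suc-D∸1 (≡.sym (vertex-dim z)))
          , eq)
        (λ (dim-U , dim-U∩z , eq) → dim⇒hasDim U (≡.trans dim-U (vertex-dim z))
          , dim⇒hasDim (space z ∩ U) (ℕ.suc-injective (≡.trans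
              (≡.trans (≡.cong (suc ∘ dim) (∩-comm (space z) U)) (≡.trans dim-U∩z (vertex-dim z)))
              (≡.sym suc-D∸1)))
          , eq))

  module _ (1≤D : 1 ≤ D) (2D<N : 2 * D < N) (x z : Vertex) (α : Subspace) (α⊆x : α ⊆ space x)
      (i : ℕ) (α-dim : HasDim α i) where
    private
      γ : Subspace
      γ = space z ∩ space x

      D′ j t : ℕ
      D′ = dim (space z)
      j  = D ∸ i
      t  = N ∸ 2 * D

      α≼x : α ≼ space x
      α≼x = ⊆⇒≼ {α} {space x} α⊆x

      dim-x≡dim-z : dim (space x) ≡ dim (space z)
      dim-x≡dim-z = ≡.trans (vertex-dim x) (≡.sym (vertex-dim z))

      dim-α : dim α ≡ i
      dim-α = hasDim⇒dim α α-dim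

      i≤D : i ≤ D
      i≤D = ≡.subst₂ _≤_ dim-α (vertex-dim x) (dim-mono α≼x)

      D≡i+j : D ≡ i + j
      D≡i+j = ≡.sym (ℕ.m+[n∸m]≡n i≤D)

      N≡2D+t : N ≡ 2 * D + t
      N≡2D+t = ≡.sym (ℕ.m+[n∸m]≡n (ℕ.<⇒≤ 2D<N))

      N≡D+[D+t] : N ≡ D + (D′ + t)
      N≡D+[D+t] = begin
        N                    ≡⟨ N≡2D+t ⟩
        D + (D + 0) + t ≡⟨ ≡.cong (λ n → D + n + t) (ℕ.+-identityʳ D) ⟩
        D + D + t        ≡⟨ ℕ.+-assoc D D t ⟩
        D + (D + t)      ≡⟨ ≡.cong (λ n → D + (n + t)) (vertex-dim z) ⟨
        D + (D′ + t)     ∎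
        where open ≡.≡-Reasoning

      eq-j : dim α + j ≡ dim (space z)
      eq-j = ≡.trans (≡.cong (_+ j) dim-α) (≡.trans (≡.sym D≡i+j) (≡.sym (vertex-dim z)))

      eq-t : dim (space z) + (dim (space z) + t) ≡ N
      eq-t = ≡.trans (≡.cong (_+ (D′ + t)) (vertex-dim z)) (≡.sym N≡D+[D+t])

      instance
        q-nonZero : NonZero q
        q-nonZero = ℕ.>-nonZero (ℕ.<-trans (s≤s z≤n) 1<q)

      g : ℕ → ℕ
      g = gauss q

      n₁ n₂ n₃ n₄ : ℕ
      n₁ = g j * (q * g (D′ + t) ∸ g j)
      n₂ = q ^ (j + pred j) * g (suc (t + dim α))
      n₃ = q ^ j
      n₄ = g (suc j)

      D-i≡j : + D ℤ.- + i ≡ + j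
      D-i≡j = pos-∸ D i D≡i+j

      coefficient₁ : [ + D ℤ.- + i ] *ᴷ (qᴷ *ᴷ [ + N ℤ.- + D ] -ᴷ [ + D ℤ.- + i ]) ≈ᴷ ι n₁
      coefficient₁ = trans
        (*-cong ([]-pos 1<q D-i≡j) (trans
          (+-cong (trans (*-congˡ ([]-pos 1<q (pos-∸ N D N≡D+[D+t]))) (sym (ι-* q (g (D′ + t)))))
                  (-‿cong ([]-pos 1<q D-i≡j)))
          (sym (ι-∸ g[j]≤))))
        (sym (ι-* (g j) _))
        where
        -- The subtraction in `n₁` does not truncate, because `j ≤ D ≤ N - D`.
        g[j]≤ : g j ≤ q * g (D′ + t)
        g[j]≤ = ℕ.≤-trans (gauss-mono q (ℕ.≤-trans (ℕ.m≤n+m j (dim α))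
          (ℕ.≤-trans (ℕ.≤-reflexive eq-j) (ℕ.m≤m+n D′ t)))) (ℕ.m≤n*m (g (D′ + t)) q)

      -- For `j = 0` the exponent is `-1` and `q^_` returns a reciprocal. The condition `1 ≤ j`
      -- comes from `above⇒1≤j`: a `γ` covering `α` needs room for dimension `i + 1` inside `z`.
      coefficient₂ : 1 ≤ j →
        q^ (+ 2 ℤ.* + D ℤ.- + 2 ℤ.* + i ℤ.- + 1) *ᴷ [ + N ℤ.- + 2 ℤ.* + D ℤ.+ + i ℤ.+ + 1 ] ≈ᴷ ι n₂
      coefficient₂ 1≤j = trans (*-cong (q^-pos 1<q exponent) ([]-pos 1<q index)) (sym (ι-* (q ^ (j + pred j)) _))
        where
        2D≡2i+2j : 2 * D ≡ 2 * i + 2 * j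
        2D≡2i+2j = ≡.trans (≡.cong (2 *_) D≡i+j) (ℕ.*-distribˡ-+ 2 i j)
        2j≡1+ : ∀ {j} → 1 ≤ j → 2 * j ≡ 1 + (j + pred j)
        2j≡1+ {suc j} _ = ≡.cong suc (≡.trans (≡.cong (λ n → j + suc n) (ℕ.+-identityʳ j)) (ℕ.+-suc j j))
        exponent : + 2 ℤ.* + D ℤ.- + 2 ℤ.* + i ℤ.- + 1 ≡ + (j + pred j)
        exponent = ≡.trans (≡.cong (ℤ._- + 1) (≡.trans
            (≡.cong₂ ℤ._-_ (≡.sym (ℤ.pos-* 2 D)) (≡.sym (ℤ.pos-* 2 i)))
            (pos-∸ (2 * D) (2 * i) 2D≡2i+2j)))
          (pos-∸ (2 * j) 1 (2j≡1+ 1≤j))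
        index : + N ℤ.- + 2 ℤ.* + D ℤ.+ + i ℤ.+ + 1 ≡ + suc (t + dim α)
        index = ≡.trans (≡.cong (λ n → n ℤ.+ + i ℤ.+ + 1) (≡.trans
            (≡.cong (λ n → + N ℤ.- n) (≡.sym (ℤ.pos-* 2 D))) (pos-∸ N (2 * D) N≡2D+t)))
          (≡.cong +_ (≡.trans (ℕ.+-comm (t + i) 1) (≡.cong (λ n → suc (t + n)) (≡.sym dim-α))))

      coefficient₃ : q^ (+ D ℤ.- + i) ≈ᴷ ι n₃
      coefficient₃ = q^-pos 1<q D-i≡j

      coefficient₄ : [ + D ℤ.- + i ℤ.+ + 1 ] ≈ᴷ ι n₄
      coefficient₄ = []-pos 1<q (≡.trans (≡.cong (ℤ._+ + 1) D-i≡j) (≡.cong +_ (ℕ.+-comm j 1)))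

      above⇒1≤j : γ ⊆ space x × γ covers α → 1 ≤ j
      above⇒1≤j (_ , c) = ℕ.+-cancelˡ-≤ (dim α) 1 j (≡.subst₂ _≤_
        (≡.trans (proj₂ (covers⇒ c)) (ℕ.+-comm 1 (dim α))) (≡.sym eq-j) (dim-mono (∩-≼ˡ (space z) (space x))))

    adjacency-action : (A *ⱽ α ^𝒩[ x ]) z ≈ᴷ
        (([ + D ℤ.- + i ] *ᴷ (qᴷ *ᴷ [ + N ℤ.- + D ] -ᴷ [ + D ℤ.- + i ])) · α ^𝒩[ x ]
      +ⱽ (q^ (+ 2 ℤ.* + D ℤ.- + 2 ℤ.* + i ℤ.- + 1) *ᴷ [ + N ℤ.- + 2 ℤ.* + D ℤ.+ + i ℤ.+ + 1 ])
           · ∑ subspaces (λ β → β ⊆? space x ×-dec β covers? α) (λ β → β ^𝒩[ x ])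
      +ⱽ q^ (+ D ℤ.- + i)
           · ∑ subspaces (λ β → β ⊆? space x ×-dec α covers? (α ∩ β) ×-dec β covers? (α ∩ β))
               (λ β → β ^𝒩[ x ])
      +ⱽ [ + D ℤ.- + i ℤ.+ + 1 ] · ∑ subspaces (λ β → α covers? β) (λ β → β ^𝒩[ x ])) z
    adjacency-action = trans
      (A𝒩-evaluate 1≤D α x z dim-x≡dim-z α≼x)
      (trans (ι-cong (count-near-cases dim-x≡dim-z α≼x j t eq-j eq-t))
        (trans (ι-+-+-+ (n₁ * 𝟙 P₁?) (n₂ * 𝟙 P₂?) (n₃ * 𝟙 P₃?) (n₄ * 𝟙 P₄?))
          (sym (+-cong (+-cong (+-cong
            (trans (*-congˡ (𝒩-evaluate α x z)) (*-ι𝟙 P₁? {n = n₁} (λ _ → coefficient₁)))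
            (trans (*-congˡ (∑𝒩-evaluate (above? (space x) α) x z)) (*-ι𝟙 P₂? {n = n₂} (coefficient₂ ∘ above⇒1≤j))))
            (trans (*-congˡ (∑𝒩-evaluate (beside? (space x) α) x z)) (*-ι𝟙 P₃? {n = n₃} (λ _ → coefficient₃))))
            (trans (*-congˡ (∑𝒩-evaluate (α covers?_) x z)) (*-ι𝟙 P₄? {n = n₄} (λ _ → coefficient₄)))))))
      where
      P₁? = γ ≟ α
      P₂? = above? (space x) α γ
      P₃? = beside? (space x) α γ
      P₄? = α covers? γ

theorem8p2 : ∀ {a ℓ₁ ℓ₂ m ℓm k ℓ₃ ℓ₄} (D N q : ℕ) → D ≥ 1 → N > 2 * D → PrimePower q →
    (F : FiniteField q a ℓ₁ ℓ₂) (𝒱 : VectorSpace F N m ℓm) (K : CharZeroField k ℓ₃ ℓ₄) →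
    let open Grassmann F 𝒱 D K in
    (x : Vertex) (α : Subspace) → α ⊆ space x → (i : ℕ) → HasDim α i →
    A *ⱽ α ^𝒩[ x ]
    ≈ⱽ ([ + D ℤ.- + i ] *ᴷ (qᴷ *ᴷ [ + N ℤ.- + D ] -ᴷ [ + D ℤ.- + i ])) · α ^𝒩[ x ]
    +ⱽ (q^ (+ 2 ℤ.* + D ℤ.- + 2 ℤ.* + i ℤ.- + 1) *ᴷ [ + N ℤ.- + 2 ℤ.* + D ℤ.+ + i ℤ.+ + 1 ])
    · ∑ subspaces (λ β → β ⊆? space x ×-dec β covers? α) (λ β → β ^𝒩[ x ])
    +ⱽ q^ (+ D ℤ.- + i)
    · ∑ subspaces (λ β → β ⊆? space x ×-dec α covers? (α ∩ β) ×-dec β covers? (α ∩ β))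
    (λ β → β ^𝒩[ x ])
    +ⱽ [ + D ℤ.- + i ℤ.+ + 1 ] · ∑ subspaces (λ β → α covers? β) (λ β → β ^𝒩[ x ])
theorem8p2 D N q D≥1 N>2D _ F 𝒱 K x α α⊆x i α-dim z =
  Evaluation.adjacency-action F 𝒱 D K D≥1 N>2D x z α α⊆x i α-dim
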